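{- Let $N$ and $M$ be large positive parameters, let $\mathcal{X}$ be any subset of $\{1,2,\ldots,10^M\}$, and let $\Delta=\Delta(N)$ be any function with $\Delta\to\infty$. Then for $\pi(N)\bigl(1+O(1/\Delta)\bigr)$ primes $p\le N$ we have $$\#\{x \bmod p \;:\; x\in\mathcal{X}\}=|\mathcal{X}|+O\!\left(\frac{|\mathcal{X}|}{1+\frac{\pi(N)\log M}{M|\mathcal{X}|\Delta}}\right).$$ That is, the number of primes $p\le N$ for which this estimate holds (with an absolute implied constant) is $\pi(N)(1+O(1/\Delta))$.
   Context: $\pi(N)$ denotes the number of primes $p\le N$. $\#\{x \bmod p : x\in\mathcal{X}\}$ is the number of distinct residues modulo $p$ of elements of $\mathcal{X}$. -}

module Defs where

open import Data.Nat as ℕ using (ℕ; zero; suc; NonZero)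
import Data.Nat.Properties as ℕₚ
import Data.Nat.DivMod as ℕ
open import Data.Nat.Primality using (Prime; prime?; prime⇒nonZero)
open import Data.Integer as ℤ using (+_; +[1+_])
import Data.Integer.Properties as ℤₚ
open import Data.Rational
  using (ℚ; mkℚ; 0ℚ; 1ℚ; ½; toℚᵘ; _+_; _*_; _-_; -_; _⊔_; ∣_∣; _≤_; _<_; *<*; *≤*; 1/_; _/_; Positive; positive; nonNegative; NonNegative)
open import Data.Rational.Properties
open import Data.Rational.Solver using (module +-*-Solver)
import Data.Rational.Unnormalised as ℚᵘ
import Data.Rational.Unnormalised.Properties as ℚᵘₚ
open import Data.List.Base using (List; length; filter; map; upTo; deduplicate)
open import Data.List.Relation.Unary.All using (All)
open import Data.List.Relation.Unary.Unique.Propositional using (Unique)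
open import Data.Product using (Σ; Σ-syntax; ∃-syntax; _×_; _,_; proj₁; proj₂)
open import Data.Sum using (inj₁; inj₂)
open import Data.List.Membership.Propositional using (_∈_)
open import Function.Bundles using (_⇔_)
open import Relation.Binary.PropositionalEquality

open +-*-Solver using (solve; _:=_; _:+_; _:*_; _:-_; :-_; con)

ℕ→ℚ : ℕ → ℚ
ℕ→ℚ n = + n / 1

∣∣≤ : ∀ {p ε} → p ≤ ε → - p ≤ ε → ∣ p ∣ ≤ ε
∣∣≤ {p} {ε} p≤ε -p≤ε with ∣p∣≡p∨∣p∣≡-p p
... | inj₁ eq = subst (_≤ ε) (sym eq) p≤ε
... | inj₂ eq = subst (_≤ ε) (sym eq) -p≤ε

within : ∀ {a ε x y} → a ≤ x → x ≤ a + ε → a ≤ y → y ≤ a + ε → ∣ x - y ∣ ≤ ε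
within {a} {ε} {x} {y} a≤x x≤ a≤y y≤ = ∣∣≤
  (subst (x - y ≤_) (cancel a ε) (+-mono-≤ x≤ (neg-antimono-≤ a≤y)))
  (subst₂ _≤_ (flip y x) (cancel a ε) (+-mono-≤ y≤ (neg-antimono-≤ a≤x)))
  where
  cancel : ∀ a ε → a + ε - a ≡ ε
  cancel = solve 2 (λ a ε → a :+ ε :- a := ε) refl
  flip : ∀ y x → y - x ≡ - (x - y)
  flip = solve 2 (λ y x → y :- x := :- (x :- y)) refl

0≤* : ∀ {p q} → 0ℚ ≤ p → 0ℚ ≤ q → 0ℚ ≤ p * q
0≤* {p} {q} 0≤p 0≤q = nonNegative⁻¹ (p * q)
  {{nonNeg*nonNeg⇒nonNeg p {{nonNegative 0≤p}} q {{nonNegative 0≤q}}}}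

0<* : ∀ {p q} → 0ℚ < p → 0ℚ < q → 0ℚ < p * q
0<* {p} {q} 0<p 0<q = positive⁻¹ (p * q)
  {{pos*pos⇒pos p {{positive 0<p}} q {{positive 0<q}}}}

*-mono-≤-nonNeg : ∀ {p q r s} → 0ℚ ≤ r → 0ℚ ≤ q → p ≤ q → r ≤ s → p * r ≤ q * s
*-mono-≤-nonNeg {p} {q} {r} {s} 0≤r 0≤q p≤q r≤s = ≤-trans
  (*-monoʳ-≤-nonNeg r {{nonNegative 0≤r}} p≤q)
  (*-monoˡ-≤-nonNeg q {{nonNegative 0≤q}} r≤s)

0≤ℕ→ℚ : ∀ n → 0ℚ ≤ ℕ→ℚ n
0≤ℕ→ℚ n = nonNegative⁻¹ (ℕ→ℚ n) {{normalize-nonNeg n 1}}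

0≤1/ : ∀ n .{{_ : NonZero n}} → 0ℚ ≤ + 1 / n
0≤1/ n = nonNegative⁻¹ (+ 1 / n) {{normalize-nonNeg 1 n}}

recip : (p : ℚ) → 0ℚ < p → ℚ
recip p 0<p = (1/ p) {{pos⇒nonZero p {{positive 0<p}}}}

0<recip : ∀ p (0<p : 0ℚ < p) → 0ℚ < recip p 0<p
0<recip p 0<p = positive⁻¹ (recip p 0<p) {{1/pos⇒pos p {{positive 0<p}}}}

*-recip : ∀ p (0<p : 0ℚ < p) → p * recip p 0<p ≡ 1ℚ
*-recip p 0<p = *-inverseʳ p {{pos⇒nonZero p {{positive 0<p}}}}

toℚᵘ-/ : ∀ n d .{{_ : NonZero d}} → toℚᵘ (n / d) ℚᵘ.≃ (n ℚᵘ./ d)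
toℚᵘ-/ n (suc d) = toℚᵘ-fromℚᵘ (ℚᵘ.mkℚᵘ n d)

toℚᵘ-*/ : ∀ m d .{{_ : NonZero d}} →
          toℚᵘ (ℕ→ℚ m * (+ 1 / d)) ℚᵘ.≃ ((+ m ℚᵘ./ 1) ℚᵘ.* (+ 1 ℚᵘ./ d))
toℚᵘ-*/ m d = ℚᵘₚ.≃-trans (toℚᵘ-homo-* (ℕ→ℚ m) (+ 1 / d))
                          (ℚᵘₚ.*-cong (toℚᵘ-/ (+ m) 1) (toℚᵘ-/ (+ 1) d))

n*1/n≡1 : ∀ n .{{_ : NonZero n}} → ℕ→ℚ n * (+ 1 / n) ≡ 1ℚ
n*1/n≡1 (suc n) = toℚᵘ-injective (ℚᵘₚ.≃-trans (toℚᵘ-*/ (suc n) (suc n))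
  (ℚᵘ.*≡* (trans (ℤₚ.*-identityʳ _) (trans (ℤₚ.*-identityʳ _)
    (sym (trans (ℤₚ.*-identityˡ _) (cong (λ k → + suc k) (ℕₚ.+-identityʳ n))))))))

archimedean : ∀ (m : ℕ) {ε} → 0ℚ < ε → ∃[ K ] ℕ→ℚ m * (+ 1 / suc K) ≤ ε
archimedean m {mkℚ (+ 0) d c} (*<* (ℤ.+<+ ()))
archimedean m {mkℚ +[1+ a ] d c} _ = K , toℚᵘ-cancel-≤
    (ℚᵘₚ.≤-respˡ-≃ (ℚᵘₚ.≃-sym (toℚᵘ-*/ m (suc K))) (ℚᵘ.*≤* leq))
  where
  K = m ℕ.* suc d
  leqℕ : m ℕ.* 1 ℕ.* suc d ℕ.≤ suc a ℕ.* (1 ℕ.* suc K)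
  leqℕ = begin
    m ℕ.* 1 ℕ.* suc d        ≡⟨ cong (ℕ._* suc d) (ℕₚ.*-identityʳ m) ⟩
    K                        ≤⟨ ℕₚ.n≤1+n K ⟩
    suc K                    ≡⟨ sym (ℕₚ.*-identityˡ (suc K)) ⟩
    1 ℕ.* suc K              ≤⟨ ℕₚ.m≤m+n (1 ℕ.* suc K) (a ℕ.* (1 ℕ.* suc K)) ⟩
    suc a ℕ.* (1 ℕ.* suc K)  ∎
    where open ℕₚ.≤-Reasoning
  leq : (+ m ℤ.* + 1) ℤ.* + suc d ℤ.≤ + suc a ℤ.* + (1 ℕ.* suc K)
  leq = subst₂ ℤ._≤_
    (trans (ℤₚ.pos-* (m ℕ.* 1) (suc d)) (cong (ℤ._* + suc d) (ℤₚ.pos-* m 1)))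
    (ℤₚ.pos-* (suc a) (1 ℕ.* suc K))
    (ℤ.+≤+ leqℕ)
archimedean m {mkℚ (ℤ.-[1+ a ]) d c} (*<* ())

antitone-1/ : ∀ {m n} → m ℕ.≤ n → + 1 / suc n ≤ + 1 / suc m
antitone-1/ {m} {n} m≤n = toℚᵘ-cancel-≤
  (ℚᵘₚ.≤-respˡ-≃ (ℚᵘₚ.≃-sym (toℚᵘ-/ (+ 1) (suc n)))
    (ℚᵘₚ.≤-respʳ-≃ (ℚᵘₚ.≃-sym (toℚᵘ-/ (+ 1) (suc m)))
      (ℚᵘ.*≤* (subst₂ ℤ._≤_ (sym (ℤₚ.*-identityˡ (+ suc m))) (sym (ℤₚ.*-identityˡ (+ suc n)))
        (ℤ.+≤+ (ℕ.s≤s m≤n))))))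

-- Real numbers as Cauchy sequences of rationals.  There is no quotient:
-- the relations _≤ᵣ_ and _<ᵣ_ only depend on the limits.

IsCauchy : (ℕ → ℚ) → Set
IsCauchy x = ∀ {ε} → 0ℚ < ε →
  ∃[ K ] (∀ {m n} → K ℕ.≤ m → K ℕ.≤ n → ∣ x m - x n ∣ ≤ ε)

record ℝ : Set where
  constructor mkℝ
  field
    seq    : ℕ → ℚ
    cauchy : IsCauchy seq

open ℝ public

infix 4 _≤ᵣ_ _<ᵣ_

_≤ᵣ_ : ℝ → ℝ → Set
x ≤ᵣ y = ∀ {ε} → 0ℚ < ε → ∃[ K ] (∀ {n} → K ℕ.≤ n → seq x n ≤ seq y n + ε)

_<ᵣ_ : ℝ → ℝ → Set
x <ᵣ y = Σ[ ε ∈ ℚ ] 0ℚ < ε × ∃[ K ] (∀ {n} → K ℕ.≤ n → seq x n + ε ≤ seq y n)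

fromℚ : ℚ → ℝ
fromℚ q = mkℝ (λ _ → q) λ {ε} 0<ε → 0 , λ _ _ →
  subst (λ r → ∣ r ∣ ≤ ε) (sym (+-inverseʳ q)) (<⇒≤ 0<ε)

fromℕ : ℕ → ℝ
fromℕ n = fromℚ (+ n / 1)

0ℝ 1ℝ : ℝ
0ℝ = fromℕ 0
1ℝ = fromℕ 1

infixl 6 _+ᵣ_ _-ᵣ_
infixl 7 _*ᵣ_
infix  8 -ᵣ_

_+ᵣ_ : ℝ → ℝ → ℝ
x +ᵣ y = mkℝ (λ n → seq x n + seq y n) cauchy-+
  where
  cauchy-+ : IsCauchy (λ n → seq x n + seq y n)
  cauchy-+ {ε} 0<ε with cauchy x (0<* 0<ε (positive⁻¹ ½)) | cauchy y (0<* 0<ε (positive⁻¹ ½))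
  ... | K , hx | L , hy = K ℕ.⊔ L , λ {m} {n} Km Kn → begin
    ∣ (seq x m + seq y m) - (seq x n + seq y n) ∣
      ≡⟨ cong ∣_∣ (rearrange (seq x m) (seq y m) (seq x n) (seq y n)) ⟩
    ∣ (seq x m - seq x n) + (seq y m - seq y n) ∣
      ≤⟨ ∣p+q∣≤∣p∣+∣q∣ (seq x m - seq x n) (seq y m - seq y n) ⟩
    ∣ seq x m - seq x n ∣ + ∣ seq y m - seq y n ∣
      ≤⟨ +-mono-≤ (hx (ℕₚ.m⊔n≤o⇒m≤o K L Km) (ℕₚ.m⊔n≤o⇒m≤o K L Kn))
                  (hy (ℕₚ.m⊔n≤o⇒n≤o K L Km) (ℕₚ.m⊔n≤o⇒n≤o K L Kn)) ⟩
    ε * ½ + ε * ½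
      ≡⟨ sym (*-distribˡ-+ ε ½ ½) ⟩
    ε * 1ℚ
      ≡⟨ *-identityʳ ε ⟩
    ε ∎
    where
    open ≤-Reasoning
    rearrange : ∀ a b c d → (a + b) - (c + d) ≡ (a - c) + (b - d)
    rearrange = solve 4 (λ a b c d → (a :+ b) :- (c :+ d) := (a :- c) :+ (b :- d)) refl

-ᵣ_ : ℝ → ℝ
-ᵣ x = mkℝ (λ n → - seq x n) cauchy-neg
  where
  cauchy-neg : IsCauchy (λ n → - seq x n)
  cauchy-neg {ε} 0<ε with cauchy x 0<ε
  ... | K , hx = K , λ {m} {n} Km Kn →
    subst (λ r → ∣ r ∣ ≤ ε) (flip (seq x n) (seq x m)) (hx Kn Km)
    where
    flip : ∀ a b → a - b ≡ - b - - a
    flip = solve 2 (λ a b → a :- b := :- b :- (:- a)) refl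

_-ᵣ_ : ℝ → ℝ → ℝ
x -ᵣ y = x +ᵣ -ᵣ y

∣_∣ᵣ : ℝ → ℝ
∣ x ∣ᵣ = mkℝ (λ n → ∣ seq x n ∣) cauchy-abs
  where
  reverse-triangle : ∀ a b → ∣ a ∣ - ∣ b ∣ ≤ ∣ a - b ∣
  reverse-triangle a b = subst₂ _≤_
    (cong (λ t → ∣ t ∣ - ∣ b ∣) (cancel a b)) (cancel′ ∣ a - b ∣ ∣ b ∣)
    (+-monoˡ-≤ (- ∣ b ∣) (∣p+q∣≤∣p∣+∣q∣ (a - b) b))
    where
    cancel : ∀ a b → (a - b) + b ≡ a
    cancel = solve 2 (λ a b → (a :- b) :+ b := a) refl
    cancel′ : ∀ a b → a + b - b ≡ a
    cancel′ = solve 2 (λ a b → (a :+ b) :- b := a) refl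
  flip : ∀ a b → a - b ≡ - (b - a)
  flip = solve 2 (λ a b → a :- b := :- (b :- a)) refl
  cauchy-abs : IsCauchy (λ n → ∣ seq x n ∣)
  cauchy-abs {ε} 0<ε with cauchy x 0<ε
  ... | K , hx = K , λ {m} {n} Km Kn → ∣∣≤
    (≤-trans (reverse-triangle (seq x m) (seq x n)) (hx Km Kn))
    (subst (_≤ ε) (flip ∣ seq x n ∣ ∣ seq x m ∣)
      (≤-trans (reverse-triangle (seq x n) (seq x m)) (hx Kn Km)))

eventuallyBounded : (x : ℝ) → Σ[ B ∈ ℚ ] 0ℚ < B × ∃[ K ] (∀ {n} → K ℕ.≤ n → ∣ seq x n ∣ ≤ B)
eventuallyBounded x with cauchy x (positive⁻¹ 1ℚ)
... | K , hx = 1ℚ + ∣ seq x K ∣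
             , positive⁻¹ (1ℚ + ∣ seq x K ∣) {{pos+nonNeg⇒pos 1ℚ ∣ seq x K ∣ {{∣-∣-nonNeg (seq x K)}}}}
             , K , λ {n} Kn → begin
    ∣ seq x n ∣                        ≡⟨ cong ∣_∣ (split (seq x n) (seq x K)) ⟩
    ∣ (seq x n - seq x K) + seq x K ∣  ≤⟨ ∣p+q∣≤∣p∣+∣q∣ (seq x n - seq x K) (seq x K) ⟩
    ∣ seq x n - seq x K ∣ + ∣ seq x K ∣ ≤⟨ +-monoˡ-≤ ∣ seq x K ∣ (hx Kn ℕₚ.≤-refl) ⟩
    1ℚ + ∣ seq x K ∣                   ∎
  where
  open ≤-Reasoning
  split : ∀ a b → a ≡ (a - b) + b
  split = solve 2 (λ a b → a := (a :- b) :+ b) refl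

product-diff : ∀ a b c d A B δ → 0ℚ ≤ A → 0ℚ ≤ B → ∣ a ∣ ≤ A → ∣ d ∣ ≤ B →
               ∣ a - c ∣ ≤ δ → ∣ b - d ∣ ≤ δ → ∣ a * b - c * d ∣ ≤ (A + B) * δ
product-diff a b c d A B δ 0≤A 0≤B a≤A d≤B a-c b-d = begin
  ∣ a * b - c * d ∣                      ≡⟨ cong ∣_∣ (rearrange a b c d) ⟩
  ∣ a * (b - d) + d * (a - c) ∣          ≤⟨ ∣p+q∣≤∣p∣+∣q∣ (a * (b - d)) (d * (a - c)) ⟩
  ∣ a * (b - d) ∣ + ∣ d * (a - c) ∣      ≡⟨ cong₂ _+_ (∣p*q∣≡∣p∣*∣q∣ a (b - d)) (∣p*q∣≡∣p∣*∣q∣ d (a - c)) ⟩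
  ∣ a ∣ * ∣ b - d ∣ + ∣ d ∣ * ∣ a - c ∣
    ≤⟨ +-mono-≤ {∣ a ∣ * ∣ b - d ∣} {A * δ} {∣ d ∣ * ∣ a - c ∣} {B * δ}
         (*-mono-≤-nonNeg {∣ a ∣} {A} {∣ b - d ∣} {δ} (0≤∣p∣ (b - d)) 0≤A a≤A b-d)
         (*-mono-≤-nonNeg {∣ d ∣} {B} {∣ a - c ∣} {δ} (0≤∣p∣ (a - c)) 0≤B d≤B a-c) ⟩
  A * δ + B * δ                          ≡⟨ sym (*-distribʳ-+ δ A B) ⟩
  (A + B) * δ                            ∎
  where
  open ≤-Reasoning
  rearrange : ∀ a b c d → a * b - c * d ≡ a * (b - d) + d * (a - c)
  rearrange = solve 4 (λ a b c d → a :* b :- c :* d := a :* (b :- d) :+ d :* (a :- c)) refl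

scale : ∀ ε p → 0ℚ < ε → 0ℚ < p → Σ[ δ ∈ ℚ ] 0ℚ < δ × p * δ ≡ ε
scale ε p 0<ε 0<p = ε * recip p 0<p , 0<* {ε} {recip p 0<p} 0<ε (0<recip p 0<p) ,
  trans (swap p ε (recip p 0<p)) (trans (cong (ε *_) (*-recip p 0<p)) (*-identityʳ ε))
  where
  swap : ∀ p ε r → p * (ε * r) ≡ ε * (p * r)
  swap = solve 3 (λ p ε r → p :* (ε :* r) := ε :* (p :* r)) refl

_*ᵣ_ : ℝ → ℝ → ℝ
x *ᵣ y = mkℝ (λ n → seq x n * seq y n) cauchy-*
  where
  Close : ℚ → Set
  Close ε = ∃[ K ] (∀ {m n} → K ℕ.≤ m → K ℕ.≤ n → ∣ seq x m * seq y m - seq x n * seq y n ∣ ≤ ε)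
  -- Plain arguments rather than `with`, which would normalise the rational
  -- arithmetic in the goal.
  combine : ∀ {ε A B δ} → 0ℚ < A → 0ℚ < B → (A + B) * δ ≡ ε →
            ∃[ K ] (∀ {n} → K ℕ.≤ n → ∣ seq x n ∣ ≤ A) →
            ∃[ K ] (∀ {n} → K ℕ.≤ n → ∣ seq y n ∣ ≤ B) →
            ∃[ K ] (∀ {m n} → K ℕ.≤ m → K ℕ.≤ n → ∣ seq x m - seq x n ∣ ≤ δ) →
            ∃[ K ] (∀ {m n} → K ℕ.≤ m → K ℕ.≤ n → ∣ seq y m - seq y n ∣ ≤ δ) →
            Close ε
  combine {ε} {A} {B} {δ} 0<A 0<B eq (K₁ , hA) (K₂ , hB) (K₃ , hx) (K₄ , hy) =
    K₁₂ ℕ.⊔ K₃₄ , λ {m} {n} Km Kn →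
    ≤-trans {∣ seq x m * seq y m - seq x n * seq y n ∣} {(A + B) * δ} {ε}
      (product-diff (seq x m) (seq y m) (seq x n) (seq y n) A B δ (<⇒≤ 0<A) (<⇒≤ 0<B)
        (hA {m} (ℕₚ.m⊔n≤o⇒m≤o K₁ K₂ (ℕₚ.m⊔n≤o⇒m≤o K₁₂ K₃₄ Km)))
        (hB {n} (ℕₚ.m⊔n≤o⇒n≤o K₁ K₂ (ℕₚ.m⊔n≤o⇒m≤o K₁₂ K₃₄ Kn)))
        (hx {m} {n} (ℕₚ.m⊔n≤o⇒m≤o K₃ K₄ (ℕₚ.m⊔n≤o⇒n≤o K₁₂ K₃₄ Km))
                    (ℕₚ.m⊔n≤o⇒m≤o K₃ K₄ (ℕₚ.m⊔n≤o⇒n≤o K₁₂ K₃₄ Kn)))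
        (hy {m} {n} (ℕₚ.m⊔n≤o⇒n≤o K₃ K₄ (ℕₚ.m⊔n≤o⇒n≤o K₁₂ K₃₄ Km))
                    (ℕₚ.m⊔n≤o⇒n≤o K₃ K₄ (ℕₚ.m⊔n≤o⇒n≤o K₁₂ K₃₄ Kn))))
      (≤-reflexive eq)
    where
    K₁₂ = K₁ ℕ.⊔ K₂
    K₃₄ = K₃ ℕ.⊔ K₄
  choose : ∀ {ε A B} → 0ℚ < A → 0ℚ < B →
           ∃[ K ] (∀ {n} → K ℕ.≤ n → ∣ seq x n ∣ ≤ A) →
           ∃[ K ] (∀ {n} → K ℕ.≤ n → ∣ seq y n ∣ ≤ B) →
           Σ[ δ ∈ ℚ ] 0ℚ < δ × (A + B) * δ ≡ ε → Close ε
  choose {ε} {A} {B} 0<A 0<B hA hB (δ , 0<δ , eq) =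
    combine {ε} {A} {B} {δ} 0<A 0<B eq hA hB (cauchy x 0<δ) (cauchy y 0<δ)
  bounded : ∀ {ε} → 0ℚ < ε →
            Σ[ A ∈ ℚ ] 0ℚ < A × ∃[ K ] (∀ {n} → K ℕ.≤ n → ∣ seq x n ∣ ≤ A) →
            Σ[ B ∈ ℚ ] 0ℚ < B × ∃[ K ] (∀ {n} → K ℕ.≤ n → ∣ seq y n ∣ ≤ B) → Close ε
  bounded {ε} 0<ε (A , 0<A , hA) (B , 0<B , hB) =
    choose {ε} {A} {B} 0<A 0<B hA hB (scale ε (A + B) 0<ε (+-mono-< {0ℚ} {A} {0ℚ} {B} 0<A 0<B))
  cauchy-* : IsCauchy (λ n → seq x n * seq y n)
  cauchy-* {ε} 0<ε = bounded {ε} 0<ε (eventuallyBounded x) (eventuallyBounded y)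

inverse-diff : ∀ ε e a b ra rb → 0ℚ ≤ e → 0ℚ ≤ a → 0ℚ ≤ ra → 0ℚ ≤ rb →
               a * ra ≡ 1ℚ → b * rb ≡ 1ℚ → 0ℚ ≤ ε → e ≤ a → e ≤ b →
               ∣ b - a ∣ ≤ ε * (e * e) → ∣ ra - rb ∣ ≤ ε
inverse-diff ε e a b ra rb 0≤e 0≤a 0≤ra 0≤rb a*ra b*rb 0≤ε e≤a e≤b h = begin
  ∣ ra - rb ∣                ≡⟨ cong ∣_∣ expand ⟩
  ∣ (b - a) * (ra * rb) ∣    ≡⟨ ∣p*q∣≡∣p∣*∣q∣ (b - a) (ra * rb) ⟩
  ∣ b - a ∣ * ∣ ra * rb ∣    ≡⟨ cong (∣ b - a ∣ *_) (0≤p⇒∣p∣≡p 0≤rr) ⟩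
  ∣ b - a ∣ * (ra * rb)
    ≤⟨ *-monoʳ-≤-nonNeg (ra * rb) {{nonNegative 0≤rr}} {∣ b - a ∣} {ε * (a * b)}
         (≤-trans {∣ b - a ∣} {ε * (e * e)} {ε * (a * b)} h
           (*-monoˡ-≤-nonNeg ε {{nonNegative 0≤ε}} {e * e} {a * b}
             (*-mono-≤-nonNeg {e} {a} {e} {b} 0≤e 0≤a e≤a e≤b))) ⟩
  ε * (a * b) * (ra * rb)    ≡⟨ regroup ε a b ra rb ⟩
  ε * ((a * ra) * (b * rb))  ≡⟨ cong (ε *_) (cong₂ _*_ a*ra b*rb) ⟩
  ε * (1ℚ * 1ℚ)              ≡⟨ *-identityʳ ε ⟩
  ε                          ∎
  where
  open ≤-Reasoning
  0≤rr : 0ℚ ≤ ra * rb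
  0≤rr = 0≤* {ra} {rb} 0≤ra 0≤rb
  regroup : ∀ e a b r s → e * (a * b) * (r * s) ≡ e * ((a * r) * (b * s))
  regroup = solve 5 (λ e a b r s → e :* (a :* b) :* (r :* s) := e :* ((a :* r) :* (b :* s))) refl
  distribute : ∀ a b r s → (b - a) * (r * s) ≡ r * (b * s) - (a * r) * s
  distribute = solve 4 (λ a b r s → (b :- a) :* (r :* s) := r :* (b :* s) :- (a :* r) :* s) refl
  expand : ra - rb ≡ (b - a) * (ra * rb)
  expand = sym (trans (distribute a b ra rb) (cong₂ _-_
    (trans (cong (ra *_) b*rb) (*-identityʳ ra))
    (trans (cong (_* rb) a*ra) (*-identityˡ rb))))

-- The witness ε of 0 < y bounds the tail of y from below, so replacing yₙ by
-- yₙ ⊔ ε makes every term invertible and changes only finitely many of them.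
inverse : (y : ℝ) → 0ℝ <ᵣ y → ℝ
inverse y (e , 0<e , K₀ , e≤y) = mkℝ (λ n → recip (seq y n ⊔ e) (0<⊔ n)) cauchy-inv
  where
  0<⊔ : ∀ n → 0ℚ < seq y n ⊔ e
  0<⊔ n = <-≤-trans 0<e (p≤q⊔p (seq y n) e)
  tail : ∀ {n} → K₀ ℕ.≤ n → seq y n ⊔ e ≡ seq y n
  tail {n} K₀n = p≥q⇒p⊔q≡p (subst (_≤ seq y n) (+-identityˡ e) (e≤y K₀n))
  recip-diff : ∀ {ε a b} (0<a : 0ℚ < a) (0<b : 0ℚ < b) → 0ℚ ≤ ε → e ≤ a → e ≤ b →
               ∣ b - a ∣ ≤ ε * (e * e) → ∣ recip a 0<a - recip b 0<b ∣ ≤ ε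
  recip-diff {ε} {a} {b} 0<a 0<b 0≤ε e≤a e≤b h =
    inverse-diff ε e a b (recip a 0<a) (recip b 0<b) (<⇒≤ 0<e) (<⇒≤ 0<a)
      (<⇒≤ (0<recip a 0<a)) (<⇒≤ (0<recip b 0<b)) (*-recip a 0<a) (*-recip b 0<b)
      0≤ε e≤a e≤b h
  combine : ∀ {ε} → 0ℚ < ε →
            ∃[ K ] (∀ {m n} → K ℕ.≤ m → K ℕ.≤ n → ∣ seq y m - seq y n ∣ ≤ ε * (e * e)) →
            ∃[ K ] (∀ {m n} → K ℕ.≤ m → K ℕ.≤ n →
              ∣ recip (seq y m ⊔ e) (0<⊔ m) - recip (seq y n ⊔ e) (0<⊔ n) ∣ ≤ ε)
  combine {ε} 0<ε (K , hy) = K₀ ℕ.⊔ K , λ {m} {n} Km Kn →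
    recip-diff {ε} {seq y m ⊔ e} {seq y n ⊔ e} (0<⊔ m) (0<⊔ n) (<⇒≤ 0<ε)
      (p≤q⊔p (seq y m) e) (p≤q⊔p (seq y n) e)
      (subst₂ (λ s t → ∣ s - t ∣ ≤ ε * (e * e))
        (sym (tail {n} (ℕₚ.m⊔n≤o⇒m≤o K₀ K Kn))) (sym (tail {m} (ℕₚ.m⊔n≤o⇒m≤o K₀ K Km)))
        (hy {n} {m} (ℕₚ.m⊔n≤o⇒n≤o K₀ K Kn) (ℕₚ.m⊔n≤o⇒n≤o K₀ K Km)))
  cauchy-inv : IsCauchy (λ n → recip (seq y n ⊔ e) (0<⊔ n))
  cauchy-inv {ε} 0<ε = combine {ε} 0<ε
    (cauchy y {ε * (e * e)} (0<* {ε} {e * e} 0<ε (0<* {e} {e} 0<e 0<e)))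

infixl 7 _÷ᵣ_⟨_⟩

_÷ᵣ_⟨_⟩ : (x y : ℝ) → 0ℝ <ᵣ y → ℝ
x ÷ᵣ y ⟨ 0<y ⟩ = x *ᵣ inverse y 0<y

_^ℚ_ : ℚ → ℕ → ℚ
r ^ℚ zero  = 1ℚ
r ^ℚ suc n = r * r ^ℚ n

-- logSum r n = r/1 + r²/2 + ⋯ + rⁿ/n, a partial sum of - log (1 - r).
logSum : ℚ → ℕ → ℚ
logSum r zero    = 0ℚ
logSum r (suc n) = logSum r n + r ^ℚ suc n * (+ 1 / suc n)

module LogConvergence (M : ℕ) .{{_ : NonZero M}} where
  u r : ℚ
  u = + 1 / M
  r = 1ℚ - u

  u≤1 : ∀ M .{{_ : NonZero M}} → + 1 / M ≤ 1ℚ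
  u≤1 (suc M) = antitone-1/ {0} {M} ℕ.z≤n

  0≤r : 0ℚ ≤ r
  0≤r = subst (_≤ r) (+-inverseʳ u) (+-monoˡ-≤ (- u) (u≤1 M))

  r≤1 : r ≤ 1ℚ
  r≤1 = subst (r ≤_) (+-identityʳ 1ℚ) (+-monoʳ-≤ 1ℚ (neg-antimono-≤ (0≤1/ M)))

  0≤^ : ∀ n → 0ℚ ≤ r ^ℚ n
  0≤^ zero    = nonNegative⁻¹ 1ℚ
  0≤^ (suc n) = 0≤* 0≤r (0≤^ n)

  ^-suc-≤ : ∀ n → r ^ℚ suc n ≤ r ^ℚ n
  ^-suc-≤ n = subst (r ^ℚ suc n ≤_) (*-identityˡ (r ^ℚ n))
    (*-monoʳ-≤-nonNeg (r ^ℚ n) {{nonNegative (0≤^ n)}} r≤1)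

  ^-anti : ∀ k j → r ^ℚ (k ℕ.+ j) ≤ r ^ℚ j
  ^-anti zero    j = ≤-refl
  ^-anti (suc k) j = ≤-trans (^-suc-≤ (k ℕ.+ j)) (^-anti k j)

  increment≥0 : ∀ n → 0ℚ ≤ r ^ℚ suc n * (+ 1 / suc n)
  increment≥0 n = 0≤* (0≤^ (suc n)) (0≤1/ (suc n))

  logSum-mono : ∀ K j → logSum r K ≤ logSum r (j ℕ.+ K)
  logSum-mono K zero    = ≤-refl
  logSum-mono K (suc j) = ≤-trans (logSum-mono K j)
    (subst (_≤ logSum r (suc j ℕ.+ K)) (+-identityʳ (logSum r (j ℕ.+ K)))
      (+-monoʳ-≤ (logSum r (j ℕ.+ K)) (increment≥0 (j ℕ.+ K))))

  0≤logSum : ∀ n → 0ℚ ≤ logSum r n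
  0≤logSum n = subst (λ k → 0ℚ ≤ logSum r k) (ℕₚ.+-identityʳ n) (logSum-mono 0 n)

  module Tail (K : ℕ) where
    b BM : ℚ
    b  = + 1 / suc K
    BM = ℕ→ℚ M * b

    geometric : ∀ p → b * p + BM * (r * p) ≡ BM * p
    geometric p = trans (expand b (ℕ→ℚ M) u p)
      (trans (cong (λ t → BM * p + b * p * (1ℚ - t)) (n*1/n≡1 M)) (collapse (BM * p) (b * p)))
      where
      expand : ∀ b m u p → b * p + m * b * ((1ℚ - u) * p) ≡ m * b * p + b * p * (1ℚ - m * u)
      expand = solve 4 (λ b m u p →
        b :* p :+ m :* b :* ((con 1ℚ :- u) :* p) := m :* b :* p :+ b :* p :* (con 1ℚ :- m :* u)) refl
      collapse : ∀ x y → x + y * (1ℚ - 1ℚ) ≡ x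
      collapse = solve 2 (λ x y → x :+ y :* (con 1ℚ :- con 1ℚ) := x) refl

    increment≤ : ∀ j → r ^ℚ suc (j ℕ.+ K) * (+ 1 / suc (j ℕ.+ K)) ≤ b * r ^ℚ j
    increment≤ j = subst (r ^ℚ suc (j ℕ.+ K) * (+ 1 / suc (j ℕ.+ K)) ≤_) (*-comm (r ^ℚ j) b)
      (*-mono-≤-nonNeg (0≤1/ (suc (j ℕ.+ K))) (0≤^ j)
        (≤-trans (^-suc-≤ (j ℕ.+ K)) (subst (λ k → r ^ℚ k ≤ r ^ℚ j) (ℕₚ.+-comm K j) (^-anti K j)))
        (antitone-1/ (ℕₚ.m≤n+m K j)))

    tail : ∀ j → logSum r (j ℕ.+ K) + BM * r ^ℚ j ≤ logSum r K + BM
    tail zero    = ≤-reflexive (cong (λ t → logSum r K + t) (*-identityʳ BM))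
    tail (suc j) = begin
      S + t + BM * (r * r ^ℚ j)               ≤⟨ +-monoˡ-≤ (BM * (r * r ^ℚ j)) (+-monoʳ-≤ S (increment≤ j)) ⟩
      S + b * r ^ℚ j + BM * (r * r ^ℚ j)      ≡⟨ +-assoc S (b * r ^ℚ j) (BM * (r * r ^ℚ j)) ⟩
      S + (b * r ^ℚ j + BM * (r * r ^ℚ j))    ≡⟨ cong (λ t → S + t) (geometric (r ^ℚ j)) ⟩
      S + BM * r ^ℚ j                         ≤⟨ tail j ⟩
      logSum r K + BM                         ∎
      where
      open ≤-Reasoning
      S = logSum r (j ℕ.+ K)
      t = r ^ℚ suc (j ℕ.+ K) * (+ 1 / suc (j ℕ.+ K))

    upper : ∀ j → logSum r (j ℕ.+ K) ≤ logSum r K + BM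
    upper j = ≤-trans
      (subst (_≤ logSum r (j ℕ.+ K) + BM * r ^ℚ j) (+-identityʳ (logSum r (j ℕ.+ K)))
        (+-monoʳ-≤ (logSum r (j ℕ.+ K)) (0≤* (0≤* (0≤ℕ→ℚ M) (0≤1/ (suc K))) (0≤^ j))))
      (tail j)

  cauchy-log : IsCauchy (logSum r)
  cauchy-log {ε} 0<ε with archimedean M 0<ε
  ... | K , BM≤ε = K , λ Km Kn → within (lo Km) (hi Km) (lo Kn) (hi Kn)
    where
    lo : ∀ {m} → K ℕ.≤ m → logSum r K ≤ logSum r m
    lo {m} Km = subst (λ k → logSum r K ≤ logSum r k) (ℕₚ.m∸n+n≡m Km) (logSum-mono K (m ℕ.∸ K))
    hi : ∀ {m} → K ℕ.≤ m → logSum r m ≤ logSum r K + ε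
    hi {m} Km = ≤-trans
      (subst (λ k → logSum r k ≤ logSum r K + Tail.BM K) (ℕₚ.m∸n+n≡m Km) (Tail.upper K (m ℕ.∸ K)))
      (+-monoʳ-≤ (logSum r K) BM≤ε)

-- log M = - log (1 - r) = Σ_{k ≥ 1} rᵏ / k  with  r = 1 - 1/M ∈ [0, 1).
log : (M : ℕ) .{{_ : NonZero M}} → ℝ
log M = mkℝ (logSum (1ℚ - + 1 / M)) (LogConvergence.cauchy-log M)

Nonneg : ℝ → Set
Nonneg x = ∀ n → 0ℚ ≤ seq x n

fromℕ-nonneg : ∀ n → Nonneg (fromℕ n)
fromℕ-nonneg n _ = 0≤ℕ→ℚ n

log-nonneg : ∀ M .{{_ : NonZero M}} → Nonneg (log M)
log-nonneg M = LogConvergence.0≤logSum M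

*-nonneg : ∀ x y → Nonneg x → Nonneg y → Nonneg (x *ᵣ y)
*-nonneg x y 0≤x 0≤y n = 0≤* (0≤x n) (0≤y n)

inverse-nonneg : ∀ y (0<y : 0ℝ <ᵣ y) → Nonneg (inverse y 0<y)
inverse-nonneg y (e , 0<e , _) n =
  <⇒≤ (0<recip (seq y n ⊔ e) (<-≤-trans 0<e (p≤q⊔p (seq y n) e)))

fromℕ-pos : ∀ n .{{_ : NonZero n}} → 0ℝ <ᵣ fromℕ n
fromℕ-pos (suc n) = ℕ→ℚ (suc n) , positive⁻¹ (ℕ→ℚ (suc n)) {{normalize-pos (suc n) 1}} , 0
                  , λ _ → ≤-reflexive (+-identityˡ (ℕ→ℚ (suc n)))

*-pos : ∀ x y → 0ℝ <ᵣ x → 0ℝ <ᵣ y → 0ℝ <ᵣ x *ᵣ y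
*-pos x y (d , 0<d , K , hx) (e , 0<e , L , hy) = d * e , 0<* 0<d 0<e , K ℕ.⊔ L , λ {n} le →
  subst (_≤ seq x n * seq y n) (sym (+-identityˡ (d * e)))
    (let d≤ = subst (_≤ seq x n) (+-identityˡ d) (hx (ℕₚ.m⊔n≤o⇒m≤o K L le))
         e≤ = subst (_≤ seq y n) (+-identityˡ e) (hy (ℕₚ.m⊔n≤o⇒n≤o K L le))
     in *-mono-≤-nonNeg (<⇒≤ 0<e) (≤-trans (<⇒≤ 0<d) d≤) d≤ e≤)

1+-pos : ∀ x → Nonneg x → 0ℝ <ᵣ 1ℝ +ᵣ x
1+-pos x 0≤x = 1ℚ , positive⁻¹ 1ℚ , 0 , λ {n} _ →
  subst (_≤ 1ℚ + seq x n) (+-comm 1ℚ 0ℚ) (+-monoʳ-≤ 1ℚ (0≤x n))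

TendsToInfinity : (ℕ → ℝ) → Set
TendsToInfinity Δ = ∀ (B : ℝ) → ∃[ N₀ ] (∀ N → N₀ ℕ.≤ N → B ≤ᵣ Δ N)

π : ℕ → ℕ
π N = length (filter prime? (upTo (suc N)))

residueCount : (p : ℕ) .{{_ : NonZero p}} → List ℕ → ℕ
residueCount p X = length (deduplicate ℕ._≟_ (map (ℕ._% p) X))

Mkδ-pos : ∀ M k .{{_ : NonZero M}} .{{_ : NonZero k}} δ → 0ℝ <ᵣ δ →
          0ℝ <ᵣ fromℕ M *ᵣ fromℕ k *ᵣ δ
Mkδ-pos M k δ 0<δ = *-pos (fromℕ M *ᵣ fromℕ k) δ
  (*-pos (fromℕ M) (fromℕ k) (fromℕ-pos M) (fromℕ-pos k)) 0<δ

ratio : (N M k : ℕ) .{{_ : NonZero M}} .{{_ : NonZero k}} (δ : ℝ) → 0ℝ <ᵣ δ → ℝ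
ratio N M k δ 0<δ =
  (fromℕ (π N) *ᵣ log M) ÷ᵣ (fromℕ M *ᵣ fromℕ k *ᵣ δ) ⟨ Mkδ-pos M k δ 0<δ ⟩

1+ratio-pos : ∀ N M k .{{_ : NonZero M}} .{{_ : NonZero k}} δ (0<δ : 0ℝ <ᵣ δ) →
              0ℝ <ᵣ 1ℝ +ᵣ ratio N M k δ 0<δ
1+ratio-pos N M k δ 0<δ = 1+-pos (ratio N M k δ 0<δ)
  (*-nonneg (fromℕ (π N) *ᵣ log M) (inverse (fromℕ M *ᵣ fromℕ k *ᵣ δ) (Mkδ-pos M k δ 0<δ))
    (*-nonneg (fromℕ (π N)) (log M) (fromℕ-nonneg (π N)) (log-nonneg M))
    (inverse-nonneg (fromℕ M *ᵣ fromℕ k *ᵣ δ) (Mkδ-pos M k δ 0<δ)))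

-- k / (1 + π(N) log M / (M k δ)).  For k = 0 the inner quotient is undefined
-- and the value is taken to be 0, its limit as k → 0.
errorTerm : (N M k : ℕ) .{{_ : NonZero M}} (δ : ℝ) → 0ℝ <ᵣ δ → ℝ
errorTerm N M zero      δ 0<δ = 0ℝ
errorTerm N M k@(suc _) δ 0<δ = fromℕ k ÷ᵣ (1ℝ +ᵣ ratio N M k δ 0<δ) ⟨ 1+ratio-pos N M k δ 0<δ ⟩

GoodPrime : (C : ℝ) (N M : ℕ) .{{_ : NonZero M}} (δ : ℝ) → 0ℝ <ᵣ δ → List ℕ → ℕ → Set
GoodPrime C N M δ 0<δ X p = Σ[ p-prime ∈ Prime p ]
  ∣ fromℕ (residueCount p {{prime⇒nonZero p-prime}} X) -ᵣ fromℕ (length X) ∣ᵣ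
    ≤ᵣ C *ᵣ errorTerm N M (length X) δ 0<δ

-- The condition n = π(N) (1 + O(1/δ)) with implied constant C.
CloseToπ : (C : ℝ) (N : ℕ) (δ : ℝ) → 0ℝ <ᵣ δ → ℕ → Set
CloseToπ C N δ 0<δ n =
  ∣ fromℕ n -ᵣ fromℕ (π N) ∣ᵣ ≤ᵣ C *ᵣ (fromℕ (π N) ÷ᵣ δ ⟨ 0<δ ⟩)

-- "The number n of p ≤ N with P p satisfies Q n", for a property P that need
-- not be decidable (an inequality between reals is not).  The second component
-- is about the exact list T of all such p, which cannot in general be computed;
-- the first exhibits, unconditionally, suitably many p with P p.
CountUpTo : ℕ → (P Q : ℕ → Set) → Set
CountUpTo N P Q =
  (Σ[ S ∈ List ℕ ] Unique S × All (λ p → p ℕ.≤ N × P p) S × Q (length S)) ×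
  ((T : List ℕ) → Unique T → (∀ p → p ∈ T ⇔ (p ℕ.≤ N × P p)) → Q (length T))

{-# OPTIONS --safe #-}
-- If X has k elements, then k − #(X mod p) is at most the number of pairs x, y ∈ X with
-- p ∣ x − y.  A difference 0 < ∣x − y∣ ≤ 10^M has O(M / log M) prime factors, so these
-- defects sum to O(k² M / log M) over all primes p.  Write R = π(N) log M / (M k Δ).
-- Since no defect exceeds k, a defect larger than a big multiple of k / (1 + R) is in
-- fact larger than a big multiple of k / R, and by Markov's inequality this happens for
-- at most π(N) / Δ primes p ≤ N.
module Submission where

open import Defs
open import Data.Nat using (ℕ; NonZero; _≤_; _^_)
open import Data.List.Base using (List)
open import Data.List.Relation.Unary.All using (All)
open import Data.List.Relation.Unary.Unique.Propositional using (Unique)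
open import Data.Product using (Σ-syntax; _×_)

import Data.Integer as ℤ
open import Data.Integer using () renaming (+_ to pos)
import Data.Integer.Properties as ℤₚ
open import Data.List.Base using ([]; _∷_; _++_; length; filter; map; upTo; deduplicate)
open import Data.List.Membership.Propositional using (_∈_)
open import Data.List.Membership.Propositional.Properties
  using (∈-∃++; ∈-++⁺ˡ; ∈-++⁺ʳ; ∈-++⁻; ∈-upTo⁺; ∈-upTo⁻; ∈-filter⁺; ∈-filter⁻)
open import Data.List.Properties using (length-filter; length-upTo; length-++; length-map; length-deduplicate)
import Data.List.Relation.Unary.All as All
open import Data.List.Relation.Unary.All using ([]; _∷_)
open import Data.List.Relation.Unary.All.Properties using (all-filter) renaming (filter⁺ to All-filter⁺)
open import Data.List.Relation.Unary.AllPairs using ([]; _∷_)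
open import Data.List.Relation.Unary.Any using (here; there)
open import Data.List.Relation.Unary.Unique.Propositional.Properties using (upTo⁺) renaming (filter⁺ to Unique-filter⁺)
open import Data.Nat
  using (zero; suc; _+_; _*_; _∸_; _<_; _⊓_; _⊔_; _≟_; _≤?_; _<?_; _%_; _/_; z≤n; s≤s; ∣_-_∣; ≢-nonZero; >-nonZero⁻¹)
open import Data.Nat.DivMod using (m≡m%n+[m/n]*n)
open import Data.Nat.Divisibility using (_∣_; _∣?_; divides)
open import Data.Nat.ListAction using (sum)
open import Data.Nat.Primality using (Prime; prime?; euclidsLemma; prime⇒irreducible; prime⇒nonZero; ¬prime[1])
open import Data.Nat.Properties
open import Data.Nat.Tactic.RingSolver using (solve-∀)
open import Data.Product using (∃-syntax; _,_; proj₁; proj₂)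
import Data.Rational as ℚ
open import Data.Rational using (ℚ; 0ℚ; 1ℚ)
import Data.Rational.Properties as ℚₚ
open import Data.Rational.Solver using (module +-*-Solver)
import Data.Rational.Unnormalised as ℚᵘ
import Data.Rational.Unnormalised.Properties as ℚᵘₚ
open import Data.Sum using (inj₁; inj₂)
open import Function using (_∘_)
open import Function.Bundles using (module Equivalence)
open import Level using (Level)
open import Relation.Binary.PropositionalEquality
open import Relation.Nullary using (¬_; yes; no; contradiction)
open import Relation.Nullary.Decidable using (¬?)
open import Relation.Unary using (Pred; Decidable)
open +-*-Solver using (solve; _:=_; _:+_; _:*_; _:-_; con)

-- Counting and double counting in lists

private
  variable
    a p q : Level
    A B : Set a

count : {P : Pred A p} → Decidable P → List A → ℕ
count P? xs = length (filter P? xs)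

count-¬ : {P : Pred A p} (P? : Decidable P) (xs : List A) →
          count P? xs + count (¬? ∘ P?) xs ≡ length xs
count-¬ P? []       = refl
count-¬ P? (x ∷ xs) with P? x
... | yes _ = cong suc (count-¬ P? xs)
... | no  _ = trans (+-suc (count P? xs) _) (cong suc (count-¬ P? xs))

count-map-≤ : {P : Pred B p} (P? : Decidable P) {Q : Pred A q} (Q? : Decidable Q)
              (f : A → B) → (∀ x → P (f x) → Q x) →
              ∀ xs → count P? (map f xs) ≤ count Q? xs
count-map-≤ P? Q? f P⇒Q []       = z≤n
count-map-≤ P? Q? f P⇒Q (x ∷ xs) with P? (f x) | Q? x
... | yes _ | yes _ = s≤s (count-map-≤ P? Q? f P⇒Q xs)
... | yes y | no ¬q = contradiction (P⇒Q x y) ¬q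
... | no  _ | yes _ = m≤n⇒m≤1+n (count-map-≤ P? Q? f P⇒Q xs)
... | no  _ | no  _ = count-map-≤ P? Q? f P⇒Q xs

count-filter-≤ : {P : Pred A p} (P? : Decidable P) {Q : Pred A q} (Q? : Decidable Q) →
                 ∀ xs → count P? (filter Q? xs) ≤ count P? xs
count-filter-≤ P? Q? []       = z≤n
count-filter-≤ P? Q? (x ∷ xs) with Q? x | count-filter-≤ P? Q? xs
... | yes _ | ih with P? x
...   | yes _ = s≤s ih
...   | no  _ = ih
count-filter-≤ P? Q? (x ∷ xs) | no _ | ih with P? x
...   | yes _ = m≤n⇒m≤1+n ih
...   | no  _ = ih

count-deduplicate-≤ : {P : Pred ℕ p} (P? : Decidable P) →
                      ∀ xs → count P? (deduplicate _≟_ xs) ≤ count P? xs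
count-deduplicate-≤ P? []       = z≤n
count-deduplicate-≤ P? (x ∷ xs) with P? x
... | yes _ = s≤s (≤-trans (count-filter-≤ P? _ (deduplicate _≟_ xs)) (count-deduplicate-≤ P? xs))
... | no  _ = ≤-trans (count-filter-≤ P? _ (deduplicate _≟_ xs)) (count-deduplicate-≤ P? xs)

-- Pigeonhole by deletion: one occurrence of the head of `xs` is cut out of `ys`, and distinctness
-- keeps the tail of `xs` inside what remains.
Unique⊆⇒length≤ : {xs ys : List A} → Unique xs → (∀ {x} → x ∈ xs → x ∈ ys) → length xs ≤ length ys
Unique⊆⇒length≤ {xs = []}     _          _  = z≤n
Unique⊆⇒length≤ {xs = x ∷ xs} (x≢ ∷ uxs) xs⊆ys with ∈-∃++ (xs⊆ys (here refl))
... | as , bs , refl = subst (suc (length xs) ≤_) (sym length-eq)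
                         (s≤s (Unique⊆⇒length≤ uxs xs⊆as++bs))
  where
  length-eq : length (as ++ x ∷ bs) ≡ suc (length (as ++ bs))
  length-eq = trans (length-++ as) (trans (+-suc (length as) (length bs)) (cong suc (sym (length-++ as))))
  xs⊆as++bs : ∀ {y} → y ∈ xs → y ∈ as ++ bs
  xs⊆as++bs y∈xs with ∈-++⁻ as (xs⊆ys (there y∈xs))
  ... | inj₁ y∈as         = ∈-++⁺ˡ y∈as
  ... | inj₂ (here y≡x)   = contradiction (sym y≡x) (All.lookup x≢ y∈xs)
  ... | inj₂ (there y∈bs) = ∈-++⁺ʳ as y∈bs

sum-count-∷ : {R : A → B → Set p} (R? : ∀ x → Decidable (R x)) (y : B) (ys : List B) (xs : List A) →
              sum (map (λ x → count (R? x) (y ∷ ys)) xs) ≡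
              count (λ x → R? x y) xs + sum (map (λ x → count (R? x) ys) xs)
sum-count-∷ R? y ys []       = refl
sum-count-∷ R? y ys (x ∷ xs) with R? x y | step
  where
  swap : ∀ a b c → a + (b + c) ≡ b + (a + c)
  swap = solve-∀
  step : count (R? x) ys + sum (map (λ x → count (R? x) (y ∷ ys)) xs) ≡
         count (λ x → R? x y) xs + (count (R? x) ys + sum (map (λ x → count (R? x) ys) xs))
  step = trans (cong (count (R? x) ys +_) (sum-count-∷ R? y ys xs))
    (swap (count (R? x) ys) (count (λ x → R? x y) xs) (sum (map (λ x → count (R? x) ys) xs)))
... | yes _ | eq = cong suc eq
... | no  _ | eq = eq

-- Double counting: the related pairs are summed by `y` instead of by `x`, and each `y` accounts for
-- at most `b / ℓ` of them. The factor `ℓ` on the left avoids the division.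
sum-count-≤ : {R : A → B → Set p} (R? : ∀ x → Decidable (R x)) (xs : List A) (ℓ b : ℕ) {ys : List B} →
              All (λ y → ℓ * count (λ x → R? x y) xs ≤ b) ys →
              ℓ * sum (map (λ x → count (R? x) ys) xs) ≤ b * length ys
sum-count-≤ R? xs ℓ b {[]} [] = ≤-reflexive (trans (cong (ℓ *_) (sum-zero xs)) (trans (*-zeroʳ ℓ) (sym (*-zeroʳ b))))
  where
  sum-zero : ∀ xs → sum (map (λ x → count (R? x) []) xs) ≡ 0
  sum-zero []       = refl
  sum-zero (_ ∷ xs) = sum-zero xs
sum-count-≤ R? xs ℓ b {y ∷ ys} (h ∷ hs) = begin
  ℓ * sum (map (λ x → count (R? x) (y ∷ ys)) xs)
    ≡⟨ cong (ℓ *_) (sum-count-∷ R? y ys xs) ⟩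
  ℓ * (count (λ x → R? x y) xs + sum (map (λ x → count (R? x) ys) xs))
    ≡⟨ *-distribˡ-+ ℓ (count (λ x → R? x y) xs) _ ⟩
  ℓ * count (λ x → R? x y) xs + ℓ * sum (map (λ x → count (R? x) ys) xs)
    ≤⟨ +-mono-≤ h (sum-count-≤ R? xs ℓ b hs) ⟩
  b + b * length ys
    ≡⟨ sym (*-suc b (length ys)) ⟩
  b * suc (length ys) ∎
  where open ≤-Reasoning

-- Markov's inequality with denominators cleared: every element listed has `f x` at least `t / c`.
markov : (f : A → ℕ) (t c : ℕ) {xs : List A} → All (λ x → t ≤ c * f x) xs →
         length xs * t ≤ c * sum (map f xs)
markov f t c []                = z≤n
markov f t c {x ∷ xs} (h ∷ hs) = ≤-trans (+-mono-≤ h (markov f t c hs))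
  (≤-reflexive (sym (*-distribˡ-+ c (f x) (sum (map f xs)))))

sum-map-+ : (f g : A → ℕ) (xs : List A) →
            sum (map (λ x → f x + g x) xs) ≡ sum (map f xs) + sum (map g xs)
sum-map-+ f g []       = refl
sum-map-+ f g (x ∷ xs) = trans (cong (f x + g x +_) (sum-map-+ f g xs)) (shuffle (f x) (g x) _ _)
  where
  shuffle : ∀ a b c d → a + b + (c + d) ≡ a + c + (b + d)
  shuffle = solve-∀

-- Prime divisors

-- The primes are divided out of `n` one at a time. By Euclid's lemma each remaining prime, being
-- different from `p`, still divides the cofactor `m`, and each step costs a factor of at least `b`.
b^length≤ : ∀ {b n} .{{_ : NonZero n}} {ps : List ℕ} → Unique ps →
            All (λ p → Prime p × p ∣ n × b ≤ p) ps → b ^ length ps ≤ n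
b^length≤ {n = n} {ps = []} _ _ = >-nonZero⁻¹ n
b^length≤ {b} {ps = p ∷ ps} (p≢ ∷ ups) ((pr , divides m refl , b≤p) ∷ hs) =
  subst (b * b ^ length ps ≤_) (*-comm p m)
    (*-mono-≤ b≤p (b^length≤ {{m*n≢0⇒m≢0 m {p}}} ups (All.map step (All.zip (p≢ , hs)))))
  where
  step : ∀ {q} → (¬ p ≡ q) × Prime q × q ∣ m * p × b ≤ q → Prime q × q ∣ m × b ≤ q
  step {q} (p≢q , prq , q∣mp , b≤q) with euclidsLemma m p prq q∣mp
  ... | inj₁ q∣m = prq , q∣m , b≤q
  ... | inj₂ q∣p with prime⇒irreducible pr q∣p
  ...   | inj₁ q≡1 = contradiction (subst Prime q≡1 prq) ¬prime[1]
  ...   | inj₂ q≡p = contradiction (sym q≡p) p≢q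

2^-cancel-≤ : ∀ m n → 2 ^ m ≤ 2 ^ n → m ≤ n
2^-cancel-≤ m n le with m ≤? n
... | yes m≤n = m≤n
... | no  m≰n = contradiction le (<⇒≱ (^-monoʳ-< 2 (s≤s (s≤s z≤n)) (≰⇒> m≰n)))

-- At most 2^h of the primes are below 2^h, and n has at most (log₂ n)/h larger prime factors.
primeDivisors≤ : ∀ h {e n} .{{_ : NonZero n}} → n ≤ 2 ^ e → {ps : List ℕ} → Unique ps →
                 All (λ p → Prime p × p ∣ n) ps → h * length ps ≤ h * 2 ^ h + e
primeDivisors≤ h {e} {n} n≤2^e {ps} ups hs = begin
  h * length ps                              ≡⟨ cong (h *_) (sym (count-¬ small? ps)) ⟩
  h * (count small? ps + count large? ps)    ≡⟨ *-distribˡ-+ h (count small? ps) _ ⟩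
  h * count small? ps + h * count large? ps  ≤⟨ +-mono-≤ (*-monoʳ-≤ h small≤) large≤ ⟩
  h * 2 ^ h + e                              ∎
  where
  open ≤-Reasoning
  small? : Decidable (_< 2 ^ h)
  small? = _<? 2 ^ h
  large? = ¬? ∘ small?
  small≤ : count small? ps ≤ 2 ^ h
  small≤ = ≤-trans (Unique⊆⇒length≤ (Unique-filter⁺ small? ups) (λ x∈ → ∈-upTo⁺ (proj₂ (∈-filter⁻ small? {xs = ps} x∈))))
    (≤-reflexive (length-upTo (2 ^ h)))
  large≤ : h * count large? ps ≤ e
  -- The large prime factors give (2^h)^count ≤ n ≤ 2^e; the exponents are then compared.
  large≤ = 2^-cancel-≤ _ e (≤-trans (≤-reflexive (sym (^-*-assoc 2 h (count large? ps))))
    (≤-trans (b^length≤ (Unique-filter⁺ large? ups)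
      (All.map (λ { (≮ , pr , d) → pr , d , ≮⇒≥ ≮ }) (All.zip (all-filter large? ps , All-filter⁺ large? hs)))) n≤2^e))

-- Base 4 makes 2^g of the size of √M. Primes are later split at 2^(g+1), and weighting the small
-- ones by g + 1 ≤ 2^g then costs only O(4^g) = O(M).
log₄-bracket : ∀ M .{{_ : NonZero M}} → ∃[ g ] 4 ^ g ≤ M × M < 4 ^ suc g
log₄-bracket (suc zero)        = 0 , s≤s z≤n , s≤s (s≤s z≤n)
log₄-bracket (suc M@(suc _)) with log₄-bracket M
... | g , lo , hi with suc M <? 4 ^ suc g
...   | yes lt = g , m≤n⇒m≤1+n lo , lt
...   | no ≮   = suc g , ≮⇒≥ ≮ , ≤-<-trans hi (^-monoʳ-< 4 (s≤s (s≤s z≤n)) (n<1+n (suc g)))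

1+g≤2^g : ∀ g → suc g ≤ 2 ^ g
1+g≤2^g zero    = s≤s z≤n
1+g≤2^g (suc g) = +-mono-≤ (m^n>0 2 g) (≤-trans (1+g≤2^g g) (m≤m+n (2 ^ g) 0))

-- log M is at most 2 (g + 1) + 1, so this is ω(n) ≪ M / log M for n ≤ 10 ^ M.
primeDivisors*log≤ : ∀ g {M n} .{{_ : NonZero n}} → 4 ^ g ≤ M → n ≤ 10 ^ M →
                     {ps : List ℕ} → Unique ps → All (λ p → Prime p × p ∣ n) ps →
                     suc (suc g + suc g) * length ps ≤ 18 * M
primeDivisors*log≤ g {M} {n} 4^g≤M n≤10^M {ps} ups hs = begin
  -- The weight 2h + 1 is at most 3h because h ≥ 1. Then h 2^h ≤ 2 · 4^g ≤ 2M, so the constant is 3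
  -- (2 + 4) = 18.
  suc (h + h) * length ps          ≤⟨ *-monoˡ-≤ (length ps) (+-monoˡ-≤ (h + h) (s≤s (z≤n {g}))) ⟩
  (h + (h + h)) * length ps        ≡⟨ triple h (length ps) ⟩
  3 * (h * length ps)              ≤⟨ *-monoʳ-≤ 3 (primeDivisors≤ h n≤2^ ups hs) ⟩
  3 * (h * 2 ^ h + 4 * M)          ≤⟨ *-monoʳ-≤ 3 (+-monoˡ-≤ (4 * M) (*-monoˡ-≤ (2 ^ h) (1+g≤2^g g))) ⟩
  3 * (2 ^ g * (2 * 2 ^ g) + 4 * M) ≡⟨ regroup (2 ^ g) M ⟩
  6 * (2 ^ g * 2 ^ g) + 12 * M     ≡⟨ cong (λ t → 6 * t + 12 * M) (sym (^-distribʳ-* g 2 2)) ⟩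
  6 * 4 ^ g + 12 * M               ≤⟨ +-monoˡ-≤ (12 * M) (*-monoʳ-≤ 6 4^g≤M) ⟩
  6 * M + 12 * M                   ≡⟨ sym (*-distribʳ-+ M 6 12) ⟩
  18 * M                           ∎
  where
  open ≤-Reasoning
  h = suc g
  triple : ∀ h w → (h + (h + h)) * w ≡ 3 * (h * w)
  triple = solve-∀
  regroup : ∀ t M → 3 * (t * (2 * t) + 4 * M) ≡ 6 * (t * t) + 12 * M
  regroup = solve-∀
  ^-distribʳ-* : ∀ n a b → (a * b) ^ n ≡ a ^ n * b ^ n
  ^-distribʳ-* zero    a b = refl
  ^-distribʳ-* (suc n) a b = trans (cong (a * b *_) (^-distribʳ-* n a b)) (shuffle a b (a ^ n) (b ^ n))
    where
    shuffle : ∀ a b c d → a * b * (c * d) ≡ a * c * (b * d)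
    shuffle = solve-∀
  n≤2^ : n ≤ 2 ^ (4 * M)
  -- 10 is rounded up to 16 = 2^4, so that e = 4M.
  n≤2^ = ≤-trans n≤10^M (≤-trans (^-monoˡ-≤ M (m≤m+n 10 6)) (≤-reflexive (^-*-assoc 2 4 M)))

-- Collisions modulo p

-- Collisions are expressed by divisibility rather than by equal residues, so that for a fixed pair
-- the primes at which it collides are the prime divisors of a single number.
collisions : ℕ → List ℕ → ℕ
collisions p []       = 0
collisions p (x ∷ xs) = count (λ y → p ∣? ∣ x - y ∣) xs + collisions p xs

%≡%⇒∣∣-∣ : ∀ x y p .{{_ : NonZero p}} → x % p ≡ y % p → p ∣ ∣ x - y ∣
%≡%⇒∣∣-∣ x y p eq = divides ∣ x / p - y / p ∣ (begin
  ∣ x - y ∣                                        ≡⟨ cong₂ ∣_-_∣ (m≡m%n+[m/n]*n x p) (trans (m≡m%n+[m/n]*n y p) (cong (_+ y / p * p) (sym eq))) ⟩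
  ∣ x % p + x / p * p - x % p + y / p * p ∣        ≡⟨ ∣m+n-m+o∣≡∣n-o∣ (x % p) _ _ ⟩
  ∣ x / p * p - y / p * p ∣                        ≡⟨ sym (*-distribʳ-∣-∣ p (x / p) (y / p)) ⟩
  ∣ x / p - y / p ∣ * p                            ∎)
  where open ≡-Reasoning

-- Putting `x` in front adds its residue and deletes the copies of it among the residues of `xs`.
-- Each deleted copy comes from some `y` in `xs` that collides with `x`, so the loss is at most the
-- number `c` of new collisions.
length≤residueCount+collisions : ∀ p .{{_ : NonZero p}} (X : List ℕ) →
                                 length X ≤ residueCount p X + collisions p X
length≤residueCount+collisions p []       = z≤n
length≤residueCount+collisions p (x ∷ xs) = s≤s (begin
  length xs                                        ≤⟨ length≤residueCount+collisions p xs ⟩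
  length rs + collisions p xs                      ≡⟨ cong (_+ collisions p xs) (sym (count-¬ same? rs)) ⟩
  count same? rs + count (¬? ∘ same?) rs + collisions p xs
    ≤⟨ +-monoˡ-≤ (collisions p xs) (+-monoˡ-≤ (count (¬? ∘ same?) rs) same≤) ⟩
  c + count (¬? ∘ same?) rs + collisions p xs      ≡⟨ cong (_+ collisions p xs) (+-comm c _) ⟩
  count (¬? ∘ same?) rs + c + collisions p xs      ≡⟨ +-assoc (count (¬? ∘ same?) rs) c _ ⟩
  count (¬? ∘ same?) rs + (c + collisions p xs)    ∎)
  where
  open ≤-Reasoning
  rs = deduplicate _≟_ (map (_% p) xs)
  c = count (λ y → p ∣? ∣ x - y ∣) xs
  same? : Decidable (x % p ≡_)
  same? = x % p ≟_
  same≤ : count same? rs ≤ c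
  same≤ = ≤-trans (count-deduplicate-≤ same? (map (_% p) xs))
    (count-map-≤ same? (λ y → p ∣? ∣ x - y ∣) (_% p) (λ y → %≡%⇒∣∣-∣ x y p) xs)

residueCount≤length : ∀ p .{{_ : NonZero p}} (X : List ℕ) → residueCount p X ≤ length X
residueCount≤length p X = ≤-trans (length-deduplicate _≟_ (map (_% p) X)) (≤-reflexive (length-map (_% p) X))

-- Induction on `X`: each new pair (x, y) is charged to the primes dividing its difference, at most
-- 18 M of them after weighting by `ℓ`. The pairs are absorbed by k + k² ≤ (k + 1)².
sum-collisions≤ : ∀ g {M} → 4 ^ g ≤ M → {X : List ℕ} → Unique X → All (_≤ 10 ^ M) X →
                  {ps : List ℕ} → Unique ps → All Prime ps →
                  suc (suc g + suc g) * sum (map (λ p → collisions p X) ps) ≤ 18 * M * (length X * length X)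
sum-collisions≤ g {M} lo {[]} _ _ {ps} _ _ =
  ≤-trans (≤-reflexive (trans (cong (suc (suc g + suc g) *_) (sum-zero ps)) (*-zeroʳ (suc (suc g + suc g))))) z≤n
  where
  sum-zero : ∀ ps → sum (map (λ p → collisions p []) ps) ≡ 0
  sum-zero []       = refl
  sum-zero (_ ∷ ps) = sum-zero ps
sum-collisions≤ g {M} lo {x ∷ xs} (x≢ ∷ uxs) (x≤ ∷ xs≤) {ps} ups prs = begin
  ℓ * sum (map (λ p → collisions p (x ∷ xs)) ps)
    ≡⟨ cong (ℓ *_) (sum-map-+ (λ p → count (λ y → p ∣? ∣ x - y ∣) xs) (λ p → collisions p xs) ps) ⟩
  ℓ * (sum (map (λ p → count (λ y → p ∣? ∣ x - y ∣) xs) ps) + sum (map (λ p → collisions p xs) ps))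
    ≡⟨ *-distribˡ-+ ℓ (sum (map (λ p → count (λ y → p ∣? ∣ x - y ∣) xs) ps)) _ ⟩
  ℓ * sum (map (λ p → count (λ y → p ∣? ∣ x - y ∣) xs) ps) + ℓ * sum (map (λ p → collisions p xs) ps)
    ≤⟨ +-mono-≤ (sum-count-≤ (λ p y → p ∣? ∣ x - y ∣) ps ℓ (18 * M) (All.map pair (All.zip (x≢ , xs≤))))
         (sum-collisions≤ g lo uxs xs≤ ups prs) ⟩
  18 * M * length xs + 18 * M * (length xs * length xs)
    ≡⟨ sym (*-distribˡ-+ (18 * M) (length xs) _) ⟩
  18 * M * (length xs + length xs * length xs)
    ≤⟨ *-monoʳ-≤ (18 * M) (*-monoʳ-≤ (suc (length xs)) (n≤1+n (length xs))) ⟩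
  18 * M * (suc (length xs) * suc (length xs)) ∎
  where
  open ≤-Reasoning
  ℓ = suc (suc g + suc g)
  pair : ∀ {y} → (¬ x ≡ y) × y ≤ 10 ^ M → ℓ * count (λ p → p ∣? ∣ x - y ∣) ps ≤ 18 * M
  -- The difference is nonzero by distinctness and is at most the larger of the two numbers.
  pair {y} (x≢y , y≤) = primeDivisors*log≤ g {{≢-nonZero (x≢y ∘ ∣m-n∣≡0⇒m≡n)}} lo
    (≤-trans (∣m-n∣≤m⊔n x y) (⊔-lub x≤ y≤)) (Unique-filter⁺ _ ups)
    (All.zip (All-filter⁺ (λ p → p ∣? ∣ x - y ∣) prs , all-filter (λ p → p ∣? ∣ x - y ∣) ps))

-- Primes with a large deficit

-- A computable bound for the number of residues lost. The collision count can be averaged over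
-- primes, while the cap by the size of `X` takes care of the 1 in 1 + R.
deficit : ℕ → List ℕ → ℕ
deficit p X = collisions p X ⊓ length X

length≤residueCount+deficit : ∀ p .{{_ : NonZero p}} (X : List ℕ) →
                              length X ≤ residueCount p X + deficit p X
length≤residueCount+deficit p X =
  ≤-trans (⊓-glb (length≤residueCount+collisions p X) (m≤n+m (length X) (residueCount p X)))
    (≤-reflexive (sym (+-distribˡ-⊓ (residueCount p X) (collisions p X) (length X))))

-- For s = M |X| d and t = 4 π(N) ℓ with d ≈ Δ and ℓ ≈ log M, this reads
-- deficit ≤ 73 |X| / (1 + t / s) with denominators cleared.  Here 73 = 1 + 4 · 18, with 18
-- the constant of sum-collisions≤.
SmallDeficit : (s t : ℕ) → List ℕ → ℕ → Set
SmallDeficit s t X p = deficit p X * (s + t) ≤ 73 * (length X * s)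

smallDeficit? : ∀ s t X → Decidable (SmallDeficit s t X)
smallDeficit? s t X p = deficit p X * (s + t) ≤? 73 * (length X * s)

-- The deficit is bounded by the size of `X` where it multiplies `s` and by the collisions where it
-- multiplies `t`. The first product uses up one of the 73 copies of `length X * s`.
¬smallDeficit⇒≤ : ∀ s t X p → ¬ SmallDeficit s t X p → 72 * (length X * s) ≤ t * collisions p X
¬smallDeficit⇒≤ s t X p large = +-cancelˡ-≤ (length X * s) _ _ (begin
  73 * (length X * s)                 ≤⟨ <⇒≤ (≰⇒> large) ⟩
  deficit p X * (s + t)               ≡⟨ *-distribˡ-+ (deficit p X) s t ⟩
  deficit p X * s + deficit p X * t   ≤⟨ +-mono-≤ (*-monoˡ-≤ s (m⊓n≤n (collisions p X) (length X)))
                                           (*-monoˡ-≤ t (m⊓n≤m (collisions p X) (length X))) ⟩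
  length X * s + collisions p X * t   ≡⟨ cong (λ u → length X * s + u) (*-comm (collisions p X) t) ⟩
  length X * s + t * collisions p X   ∎)
  where open ≤-Reasoning

-- Markov's inequality applied to the collisions of the bad primes. The 4 in the weight `t` and the
-- 18 from the collision sum give 72, so 72 M k² cancels and leaves (number of bad primes) · d ≤ m.
largeDeficit-rare : ∀ g {M} .{{_ : NonZero M}} → 4 ^ g ≤ M →
                    {X : List ℕ} → Unique X → All (_≤ 10 ^ M) X → ∀ d m →
                    {ps : List ℕ} → Unique ps → All Prime ps →
                    All (λ p → ¬ SmallDeficit (M * length X * d) (4 * m * suc (suc g + suc g)) X p) ps →
                    length ps * d ≤ m
-- For empty `X` the deficit is 0, so no prime can be bad.
largeDeficit-rare g lo {[]} _ _ d m {[]}     _ _ _           = z≤n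
largeDeficit-rare g lo {[]} _ _ d m {_ ∷ _}  _ _ (large ∷ _) = contradiction z≤n large
largeDeficit-rare g {M} lo {X@(_ ∷ _)} uX X≤ d m {ps} ups prs large =
  *-cancelʳ-≤ (length ps * d) m (72 * (M * (k * k)))
    {{m*n≢0 72 (M * (k * k))}} (begin
    length ps * d * (72 * (M * (k * k)))        ≡⟨ regroup₁ (length ps) d M k ⟩
    length ps * (72 * (k * (M * k * d)))        ≤⟨ markov (λ p → collisions p X) _ t (All.map (λ {p} → ¬smallDeficit⇒≤ (M * k * d) t X p) large) ⟩
    4 * m * ℓ * Σcollisions                     ≡⟨ *-assoc (4 * m) ℓ Σcollisions ⟩
    4 * m * (ℓ * Σcollisions)                   ≤⟨ *-monoʳ-≤ (4 * m) (sum-collisions≤ g lo uX X≤ ups prs) ⟩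
    4 * m * (18 * M * (k * k))                  ≡⟨ regroup₂ m M k ⟩
    m * (72 * (M * (k * k)))                    ∎)
  where
  open ≤-Reasoning
  k = length X
  instance
    k*k≢0 : NonZero (k * k)
    k*k≢0 = m*n≢0 k k
    M*k*k≢0 : NonZero (M * (k * k))
    M*k*k≢0 = m*n≢0 M (k * k)
  ℓ = suc (suc g + suc g)
  t = 4 * m * ℓ
  Σcollisions = sum (map (λ p → collisions p X) ps)
  regroup₁ : ∀ b d M k → b * d * (72 * (M * (k * k))) ≡ b * (72 * (k * (M * k * d)))
  regroup₁ = solve-∀
  regroup₂ : ∀ m M k → 4 * m * (18 * M * (k * k)) ≡ m * (72 * (M * (k * k)))
  regroup₂ = solve-∀

-- Estimates for the rational approximations

ℕ→ℚ-+ : ∀ m n → ℕ→ℚ (m + n) ≡ ℕ→ℚ m ℚ.+ ℕ→ℚ n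
ℕ→ℚ-+ m n = ℚₚ.toℚᵘ-injective (begin
  ℚ.toℚᵘ (ℕ→ℚ (m + n))                 ≈⟨ toℚᵘ-/ (pos (m + n)) 1 ⟩
  pos (m + n) ℚᵘ./ 1                     ≈⟨ ℚᵘ.*≡* (cong (ℤ._* pos 1) (sym (cong₂ ℤ._+_ (ℤₚ.*-identityʳ (pos m)) (ℤₚ.*-identityʳ (pos n))))) ⟩
  (pos m ℚᵘ./ 1) ℚᵘ.+ (pos n ℚᵘ./ 1)       ≈⟨ ℚᵘₚ.+-cong (toℚᵘ-/ (pos m) 1) (toℚᵘ-/ (pos n) 1) ⟨
  ℚ.toℚᵘ (ℕ→ℚ m) ℚᵘ.+ ℚ.toℚᵘ (ℕ→ℚ n)   ≈⟨ ℚₚ.toℚᵘ-homo-+ (ℕ→ℚ m) (ℕ→ℚ n) ⟨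
  ℚ.toℚᵘ (ℕ→ℚ m ℚ.+ ℕ→ℚ n)             ∎)
  where open ℚᵘₚ.≃-Reasoning

ℕ→ℚ-* : ∀ m n → ℕ→ℚ (m * n) ≡ ℕ→ℚ m ℚ.* ℕ→ℚ n
ℕ→ℚ-* m n = ℚₚ.toℚᵘ-injective (begin
  ℚ.toℚᵘ (ℕ→ℚ (m * n))                 ≈⟨ toℚᵘ-/ (pos (m * n)) 1 ⟩
  pos (m * n) ℚᵘ./ 1                     ≈⟨ ℚᵘ.*≡* (cong (ℤ._* pos 1) (ℤₚ.pos-* m n)) ⟩
  (pos m ℚᵘ./ 1) ℚᵘ.* (pos n ℚᵘ./ 1)       ≈⟨ ℚᵘₚ.*-cong (toℚᵘ-/ (pos m) 1) (toℚᵘ-/ (pos n) 1) ⟨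
  ℚ.toℚᵘ (ℕ→ℚ m) ℚᵘ.* ℚ.toℚᵘ (ℕ→ℚ n)   ≈⟨ ℚₚ.toℚᵘ-homo-* (ℕ→ℚ m) (ℕ→ℚ n) ⟨
  ℚ.toℚᵘ (ℕ→ℚ m ℚ.* ℕ→ℚ n)             ∎)
  where open ℚᵘₚ.≃-Reasoning

ℕ→ℚ-mono-≤ : ∀ {m n} → m ≤ n → ℕ→ℚ m ℚ.≤ ℕ→ℚ n
ℕ→ℚ-mono-≤ {m} {n} m≤n = ℚₚ.toℚᵘ-cancel-≤
  (ℚᵘₚ.≤-respˡ-≃ (ℚᵘₚ.≃-sym (toℚᵘ-/ (pos m) 1)) (ℚᵘₚ.≤-respʳ-≃ (ℚᵘₚ.≃-sym (toℚᵘ-/ (pos n) 1))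
    (ℚᵘ.*≤* (ℤₚ.*-monoʳ-≤-nonNeg (pos 1) (ℤ.+≤+ m≤n)))))

0<ℕ→ℚ : ∀ n .{{_ : NonZero n}} → 0ℚ ℚ.< ℕ→ℚ n
0<ℕ→ℚ n = ℚₚ.positive⁻¹ (ℕ→ℚ n) {{ℚₚ.normalize-pos n 1}}

recip-*-cancel : ∀ x (0<x : 0ℚ ℚ.< x) c → c ℚ.* recip x 0<x ℚ.* x ≡ c
recip-*-cancel x 0<x c = trans (ℚₚ.*-assoc c (recip x 0<x) x)
  (trans (cong (c ℚ.*_) (trans (ℚₚ.*-comm (recip x 0<x) x) (*-recip x 0<x))) (ℚₚ.*-identityʳ c))

≤*recip : ∀ {b c} x (0<x : 0ℚ ℚ.< x) → b ℚ.* x ℚ.≤ c → b ℚ.≤ c ℚ.* recip x 0<x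
≤*recip {b} {c} x 0<x b*x≤c = ℚₚ.*-cancelʳ-≤-pos x {{ℚ.positive 0<x}}
  (subst (b ℚ.* x ℚ.≤_) (sym (recip-*-cancel x 0<x c)) b*x≤c)

*recip≤ : ∀ {b c} x (0<x : 0ℚ ℚ.< x) → b ℚ.≤ c ℚ.* x → b ℚ.* recip x 0<x ℚ.≤ c
*recip≤ {b} {c} x 0<x b≤c*x = ℚₚ.*-cancelʳ-≤-pos x {{ℚ.positive 0<x}}
  (subst (ℚ._≤ c ℚ.* x) (sym (recip-*-cancel x 0<x b)) b≤c*x)

∣-∣≤ : ∀ {m n} e → m ≤ n → n ≤ m + e → ℚ.∣ ℕ→ℚ m ℚ.- ℕ→ℚ n ∣ ℚ.≤ ℕ→ℚ e
∣-∣≤ {m} {n} e m≤n n≤m+e = within {ℕ→ℚ m} {ℕ→ℚ e} {ℕ→ℚ m} {ℕ→ℚ n}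
  ℚₚ.≤-refl (subst (ℕ→ℚ m ℚ.≤_) (ℕ→ℚ-+ m e) (ℕ→ℚ-mono-≤ (m≤m+n m e)))
  (ℕ→ℚ-mono-≤ m≤n) (subst (ℕ→ℚ n ℚ.≤_) (ℕ→ℚ-+ m e) (ℕ→ℚ-mono-≤ n≤m+e))

-- The archimedean property supplies some natural number above `x`; a downward search from it stops
-- at the least one.
ceiling : ∀ x → 0ℚ ℚ.< x → ∃[ d ] x ℚ.≤ ℕ→ℚ d × ℕ→ℚ d ℚ.≤ x ℚ.+ 1ℚ
ceiling x 0<x with archimedean 1 (0<recip x 0<x)
... | K , 1/K≤1/x = search (suc K) x≤K
  where
  open ℚₚ.≤-Reasoning
  x≤K : x ℚ.≤ ℕ→ℚ (suc K)
  x≤K = begin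
    x                                                   ≡⟨ ℚₚ.*-identityʳ x ⟨
    x ℚ.* 1ℚ                                            ≡⟨ cong (x ℚ.*_) (n*1/n≡1 (suc K)) ⟨
    x ℚ.* (ℕ→ℚ (suc K) ℚ.* (pos 1 ℚ./ suc K))             ≡⟨ cong (λ t → x ℚ.* (ℕ→ℚ (suc K) ℚ.* t)) (ℚₚ.*-identityˡ (pos 1 ℚ./ suc K)) ⟨
    x ℚ.* (ℕ→ℚ (suc K) ℚ.* (1ℚ ℚ.* (pos 1 ℚ./ suc K)))
      ≤⟨ ℚₚ.*-monoˡ-≤-nonNeg x {{ℚ.nonNegative (ℚₚ.<⇒≤ 0<x)}}
           (ℚₚ.*-monoˡ-≤-nonNeg (ℕ→ℚ (suc K)) {{ℚ.nonNegative (0≤ℕ→ℚ (suc K))}} 1/K≤1/x) ⟩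
    x ℚ.* (ℕ→ℚ (suc K) ℚ.* recip x 0<x)                 ≡⟨ ℚₚ.*-comm x (ℕ→ℚ (suc K) ℚ.* recip x 0<x) ⟩
    ℕ→ℚ (suc K) ℚ.* recip x 0<x ℚ.* x                   ≡⟨ recip-*-cancel x 0<x (ℕ→ℚ (suc K)) ⟩
    ℕ→ℚ (suc K)                                         ∎
  search : ∀ n → x ℚ.≤ ℕ→ℚ n → ∃[ d ] x ℚ.≤ ℕ→ℚ d × ℕ→ℚ d ℚ.≤ x ℚ.+ 1ℚ
  search zero    x≤0 = contradiction (ℚₚ.<-≤-trans 0<x x≤0) (ℚₚ.<-irrefl refl)
  search (suc n) x≤n+1 with x ℚₚ.≤? ℕ→ℚ n
  ... | yes x≤n = search n x≤n
  ... | no  x≰n = suc n , x≤n+1 , (begin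
    ℕ→ℚ (suc n)        ≡⟨ cong ℕ→ℚ (+-comm 1 n) ⟩
    ℕ→ℚ (n + 1)        ≡⟨ ℕ→ℚ-+ n 1 ⟩
    ℕ→ℚ n ℚ.+ 1ℚ       ≤⟨ ℚₚ.+-monoˡ-≤ 1ℚ (ℚₚ.<⇒≤ (ℚₚ.≰⇒> x≰n)) ⟩
    x ℚ.+ 1ℚ           ∎)

-- An upper bound for the logarithm

-- This is 2^L - 1. The recursion displays the dyadic block after K = `mersenne L` as exactly K + 1
-- further terms.
mersenne : ℕ → ℕ
mersenne zero    = 0
mersenne (suc L) = suc (mersenne L) + mersenne L

suc-mersenne : ∀ L → suc (mersenne L) ≡ 2 ^ L
suc-mersenne zero    = refl
suc-mersenne (suc L) = trans (sym (+-suc (suc (mersenne L)) (mersenne L)))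
  (trans (cong₂ _+_ (suc-mersenne L) (suc-mersenne L)) (cong (2 ^ L +_) (sym (+-identityʳ (2 ^ L)))))

module LogBound (M : ℕ) .{{_ : NonZero M}} where
  open LogConvergence M using (r; ^-anti; module Tail)

  logSum-increase : ∀ K j → logSum r (j + K) ℚ.≤ logSum r K ℚ.+ ℕ→ℚ j ℚ.* (pos 1 ℚ./ suc K)
  logSum-increase K zero    = ℚₚ.≤-reflexive (sym (trans (cong (logSum r K ℚ.+_) (ℚₚ.*-zeroˡ (pos 1 ℚ./ suc K))) (ℚₚ.+-identityʳ (logSum r K))))
  logSum-increase K (suc j) = begin
    logSum r (j + K) ℚ.+ r ^ℚ suc (j + K) ℚ.* (pos 1 ℚ./ suc (j + K))
      ≤⟨ ℚₚ.+-mono-≤ (logSum-increase K j) (ℚₚ.≤-trans (Tail.increment≤ K j)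
           (ℚₚ.*-monoˡ-≤-nonNeg b {{ℚ.nonNegative (0≤1/ (suc K))}} (subst (λ i → r ^ℚ i ℚ.≤ 1ℚ) (+-identityʳ j) (^-anti j 0)))) ⟩
    logSum r K ℚ.+ ℕ→ℚ j ℚ.* b ℚ.+ b ℚ.* 1ℚ
      ≡⟨ regroup (logSum r K) (ℕ→ℚ j) b ⟩
    logSum r K ℚ.+ (1ℚ ℚ.+ ℕ→ℚ j) ℚ.* b
      ≡⟨ cong (λ t → logSum r K ℚ.+ t ℚ.* b) (ℕ→ℚ-+ 1 j) ⟨
    logSum r K ℚ.+ ℕ→ℚ (suc j) ℚ.* b ∎
    where
    open ℚₚ.≤-Reasoning
    b = pos 1 ℚ./ suc K
    regroup : ∀ s j b → s ℚ.+ j ℚ.* b ℚ.+ b ℚ.* 1ℚ ≡ s ℚ.+ (1ℚ ℚ.+ j) ℚ.* b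
    regroup = solve 3 (λ s j b → s :+ j :* b :+ b :* con 1ℚ := s :+ (con 1ℚ :+ j) :* b) refl

  -- Cauchy condensation: the K + 1 terms with indices K + 1 to 2K + 1 are each at most 1 / (K + 1),
  -- so every block adds at most 1.
  logSum-mersenne≤ : ∀ L → logSum r (mersenne L) ℚ.≤ ℕ→ℚ L
  logSum-mersenne≤ zero    = ℚₚ.≤-refl
  logSum-mersenne≤ (suc L) = begin
    logSum r (suc K + K)                                     ≤⟨ logSum-increase K (suc K) ⟩
    logSum r K ℚ.+ ℕ→ℚ (suc K) ℚ.* (pos 1 ℚ./ suc K)           ≡⟨ cong (logSum r K ℚ.+_) (n*1/n≡1 (suc K)) ⟩
    logSum r K ℚ.+ 1ℚ                                        ≤⟨ ℚₚ.+-monoˡ-≤ 1ℚ (logSum-mersenne≤ L) ⟩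
    ℕ→ℚ L ℚ.+ 1ℚ                                             ≡⟨ ℕ→ℚ-+ L 1 ⟨
    ℕ→ℚ (L + 1)                                              ≡⟨ cong ℕ→ℚ (+-comm L 1) ⟩
    ℕ→ℚ (suc L)                                              ∎
    where
    open ℚₚ.≤-Reasoning
    K = mersenne L

  -- Beyond K = 2^L - 1 the series is dominated by a geometric one with sum M / (K + 1) ≤ 1, which
  -- is the extra 1 in `suc L`.
  logSum≤ : ∀ L → M ≤ 2 ^ L → ∀ {n} → mersenne L ≤ n → logSum r n ℚ.≤ ℕ→ℚ (suc L)
  logSum≤ L M≤2^L {n} K≤n = begin
    logSum r n                                               ≡⟨ cong (logSum r) (m∸n+n≡m K≤n) ⟨
    logSum r (n ∸ K + K)                                     ≤⟨ Tail.upper K (n ∸ K) ⟩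
    logSum r K ℚ.+ ℕ→ℚ M ℚ.* (pos 1 ℚ./ suc K)
      ≤⟨ ℚₚ.+-mono-≤ (logSum-mersenne≤ L) (ℚₚ.*-monoʳ-≤-nonNeg (pos 1 ℚ./ suc K) {{ℚ.nonNegative (0≤1/ (suc K))}}
           (ℕ→ℚ-mono-≤ (≤-trans M≤2^L (≤-reflexive (sym (suc-mersenne L)))))) ⟩
    ℕ→ℚ L ℚ.+ ℕ→ℚ (suc K) ℚ.* (pos 1 ℚ./ suc K)                ≡⟨ cong (ℕ→ℚ L ℚ.+_) (n*1/n≡1 (suc K)) ⟩
    ℕ→ℚ L ℚ.+ 1ℚ                                             ≡⟨ ℕ→ℚ-+ L 1 ⟨
    ℕ→ℚ (L + 1)                                              ≡⟨ cong ℕ→ℚ (+-comm L 1) ⟩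
    ℕ→ℚ (suc L)                                              ∎
    where
    open ℚₚ.≤-Reasoning
    K = mersenne L

-- Comparison with the error term

-- Here `l` approximates log M, `ρ` approximates 1 / (M k Δ), `m` is π(N) and `s` is M k d. The
-- maximum with 1 comes from the truncation in `inverse`; it leaves `y` unchanged because 1 ≤ y.
1+ratio-upper : ∀ s m l ℓ ρ → 0ℚ ℚ.≤ s → 0ℚ ℚ.≤ m → 0ℚ ℚ.≤ l → l ℚ.≤ ℓ → 0ℚ ℚ.≤ ρ → s ℚ.* ρ ℚ.≤ ℕ→ℚ 4 →
                ((1ℚ ℚ.+ m ℚ.* l ℚ.* ρ) ℚ.⊔ 1ℚ) ℚ.* s ℚ.≤ s ℚ.+ ℕ→ℚ 4 ℚ.* m ℚ.* ℓ
1+ratio-upper s m l ℓ ρ 0≤s 0≤m 0≤l l≤ℓ 0≤ρ sρ≤4 = begin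
  (y ℚ.⊔ 1ℚ) ℚ.* s                     ≤⟨ ℚₚ.*-monoʳ-≤-nonNeg s {{ℚ.nonNegative 0≤s}} {y ℚ.⊔ 1ℚ} {y} y⊔1≤y ⟩
  y ℚ.* s                              ≡⟨ expand (m ℚ.* l) s ρ ⟩
  s ℚ.+ m ℚ.* l ℚ.* (s ℚ.* ρ)
    ≤⟨ ℚₚ.+-monoʳ-≤ s {m ℚ.* l ℚ.* (s ℚ.* ρ)} {m ℚ.* ℓ ℚ.* four}
         (*-mono-≤-nonNeg {m ℚ.* l} {m ℚ.* ℓ} {s ℚ.* ρ} {four}
           (0≤* {s} {ρ} 0≤s 0≤ρ) (0≤* {m} {ℓ} 0≤m (ℚₚ.≤-trans {0ℚ} {l} {ℓ} 0≤l l≤ℓ))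
           (ℚₚ.*-monoˡ-≤-nonNeg m {{ℚ.nonNegative 0≤m}} {l} {ℓ} l≤ℓ) sρ≤4) ⟩
  s ℚ.+ m ℚ.* ℓ ℚ.* four               ≡⟨ cong (s ℚ.+_) (regroup m ℓ four) ⟩
  s ℚ.+ four ℚ.* m ℚ.* ℓ               ∎
  where
  open ℚₚ.≤-Reasoning
  four = ℕ→ℚ 4
  y = 1ℚ ℚ.+ m ℚ.* l ℚ.* ρ
  y⊔1≤y : y ℚ.⊔ 1ℚ ℚ.≤ y
  y⊔1≤y = ℚₚ.⊔-lub {y} {y} {1ℚ} (ℚₚ.≤-refl {y}) (subst (ℚ._≤ y) (ℚₚ.+-identityʳ 1ℚ)
    (ℚₚ.+-monoʳ-≤ 1ℚ {0ℚ} {m ℚ.* l ℚ.* ρ} (0≤* {m ℚ.* l} {ρ} (0≤* {m} {l} 0≤m 0≤l) 0≤ρ)))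
  expand : ∀ c s ρ → (1ℚ ℚ.+ c ℚ.* ρ) ℚ.* s ≡ s ℚ.+ c ℚ.* (s ℚ.* ρ)
  expand = solve 3 (λ c s ρ → (con 1ℚ :+ c :* ρ) :* s := s :+ c :* (s :* ρ)) refl
  regroup : ∀ m ℓ f → m ℚ.* ℓ ℚ.* f ≡ f ℚ.* m ℚ.* ℓ
  regroup = solve 3 (λ m ℓ f → m :* ℓ :* f := f :* m :* ℓ) refl

-- Returns from the cleared inequality of `SmallDeficit`, with w = s + t, to a quotient by the
-- approximation `z` of 1 + R.
≤*[*recip] : ∀ D c k s w z (0<z : 0ℚ ℚ.< z) → 0ℚ ℚ.≤ D → 0ℚ ℚ.< s → z ℚ.* s ℚ.≤ w →
             D ℚ.* w ℚ.≤ c ℚ.* (k ℚ.* s) → D ℚ.≤ c ℚ.* (k ℚ.* recip z 0<z)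
≤*[*recip] D c k s w z 0<z 0≤D 0<s zs≤w Dw≤cks =
  subst (D ℚ.≤_) (ℚₚ.*-assoc c k (recip z 0<z))
    (≤*recip {D} {c ℚ.* k} z 0<z (ℚₚ.*-cancelʳ-≤-pos {D ℚ.* z} {c ℚ.* k} s {{ℚ.positive 0<s}} (begin
      D ℚ.* z ℚ.* s             ≡⟨ ℚₚ.*-assoc D z s ⟩
      D ℚ.* (z ℚ.* s)           ≤⟨ ℚₚ.*-monoˡ-≤-nonNeg D {{ℚ.nonNegative 0≤D}} {z ℚ.* s} {w} zs≤w ⟩
      D ℚ.* w                   ≤⟨ Dw≤cks ⟩
      c ℚ.* (k ℚ.* s)           ≡⟨ ℚₚ.*-assoc c k s ⟨
      c ℚ.* k ℚ.* s             ∎)))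
  where open ℚₚ.≤-Reasoning

-- Natural number approximations of Δ(N)

-- A natural number in place of δ makes the classification of the primes decidable.
NatApprox : ℝ → ℕ → Set
NatApprox δ d = ∃[ K ] (∀ {n} → K ≤ n → seq δ n ℚ.≤ ℕ→ℚ d × ℕ→ℚ d ℚ.≤ ℕ→ℚ 4 ℚ.* seq δ n)

-- The order on reals bounds the terms only up to ε, so the bound 2 is used with ε = 1.
eventually≥1 : ∀ δ → fromℕ 2 ≤ᵣ δ → ∃[ K ] (∀ {n} → K ≤ n → 1ℚ ℚ.≤ seq δ n)
eventually≥1 δ 2≤δ with 2≤δ (ℚₚ.positive⁻¹ 1ℚ)
... | K , h = K , λ {n} K≤n → subst (1ℚ ℚ.≤_) (cancel (seq δ n)) (ℚₚ.+-monoˡ-≤ (ℚ.- 1ℚ) (h K≤n))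
  where
  cancel : ∀ x → x ℚ.+ 1ℚ ℚ.- 1ℚ ≡ x
  cancel = solve 1 (λ x → x :+ con 1ℚ :- con 1ℚ := x) refl

≤+1 : ∀ x y → ℚ.∣ x ℚ.- y ∣ ℚ.≤ 1ℚ → x ℚ.≤ y ℚ.+ 1ℚ
≤+1 x y h = subst (ℚ._≤ y ℚ.+ 1ℚ) (cancel x y) (ℚₚ.+-monoʳ-≤ y (ℚₚ.≤-trans (p≤∣p∣ (x ℚ.- y)) h))
  where
  cancel : ∀ x y → y ℚ.+ (x ℚ.- y) ≡ x
  cancel = solve 2 (λ x y → y :+ (x :- y) := x) refl
  p≤∣p∣ : ∀ p → p ℚ.≤ ℚ.∣ p ∣
  p≤∣p∣ p with ℚₚ.≤-total 0ℚ p
  ... | inj₁ 0≤p = ℚₚ.≤-reflexive (sym (ℚₚ.0≤p⇒∣p∣≡p 0≤p))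
  ... | inj₂ p≤0 = ℚₚ.≤-trans p≤0 (ℚₚ.0≤∣p∣ p)

x+3≤4x : ∀ x → 1ℚ ℚ.≤ x → x ℚ.+ 1ℚ ℚ.+ 1ℚ ℚ.+ 1ℚ ℚ.≤ ℕ→ℚ 4 ℚ.* x
x+3≤4x x 1≤x = begin
  x ℚ.+ 1ℚ ℚ.+ 1ℚ ℚ.+ 1ℚ
    ≤⟨ ℚₚ.+-mono-≤ {x ℚ.+ 1ℚ ℚ.+ 1ℚ} {x ℚ.+ x ℚ.+ x} {1ℚ} {x}
         (ℚₚ.+-mono-≤ {x ℚ.+ 1ℚ} {x ℚ.+ x} {1ℚ} {x} (ℚₚ.+-monoʳ-≤ x {1ℚ} {x} 1≤x) 1≤x) 1≤x ⟩
  x ℚ.+ x ℚ.+ x ℚ.+ x       ≡⟨ quadruple x ⟩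
  ℕ→ℚ 4 ℚ.* x               ∎
  where
  open ℚₚ.≤-Reasoning
  quadruple : ∀ x → x ℚ.+ x ℚ.+ x ℚ.+ x ≡ ℕ→ℚ 4 ℚ.* x
  quadruple = solve 1 (λ x → x :+ x :+ x :+ x := con (ℕ→ℚ 4) :* x) refl

-- Take `d` as the ceiling of x + 1, where x = `seq δ K` is within 1 of all later terms. Then `d`
-- exceeds those terms, and d ≤ x + 2 is at most a later term plus 3, hence at most 4 times that
-- term since it is at least 1.
natApprox : ∀ δ → ∃[ K ] (∀ {n} → K ≤ n → 1ℚ ℚ.≤ seq δ n) → ∃[ d ] NatApprox δ d
natApprox δ (K₁ , 1≤δ) = choose (cauchy δ (ℚₚ.positive⁻¹ 1ℚ))
  where
  open ℚₚ.≤-Reasoning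
  combine : ∀ K → K₁ ≤ K → (∀ {n} → K ≤ n → ℚ.∣ seq δ n ℚ.- seq δ K ∣ ℚ.≤ 1ℚ × ℚ.∣ seq δ K ℚ.- seq δ n ∣ ℚ.≤ 1ℚ) →
            ∃[ d ] seq δ K ℚ.+ 1ℚ ℚ.≤ ℕ→ℚ d × ℕ→ℚ d ℚ.≤ seq δ K ℚ.+ 1ℚ ℚ.+ 1ℚ → ∃[ d ] NatApprox δ d
  combine K K₁≤K close (d , lo , hi) = d , K , λ {n} K≤n →
    ℚₚ.≤-trans {seq δ n} {seq δ K ℚ.+ 1ℚ} {ℕ→ℚ d} (≤+1 (seq δ n) (seq δ K) (proj₁ (close K≤n))) lo ,
    (begin
      ℕ→ℚ d                               ≤⟨ hi ⟩
      seq δ K ℚ.+ 1ℚ ℚ.+ 1ℚ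
        ≤⟨ ℚₚ.+-monoˡ-≤ 1ℚ {seq δ K ℚ.+ 1ℚ} {seq δ n ℚ.+ 1ℚ ℚ.+ 1ℚ}
             (ℚₚ.+-monoˡ-≤ 1ℚ {seq δ K} {seq δ n ℚ.+ 1ℚ} (≤+1 (seq δ K) (seq δ n) (proj₂ (close K≤n)))) ⟩
      seq δ n ℚ.+ 1ℚ ℚ.+ 1ℚ ℚ.+ 1ℚ        ≤⟨ x+3≤4x (seq δ n) (1≤δ (≤-trans K₁≤K K≤n)) ⟩
      ℕ→ℚ 4 ℚ.* seq δ n                   ∎)
  0<+1 : ∀ x → 1ℚ ℚ.≤ x → 0ℚ ℚ.< x ℚ.+ 1ℚ
  0<+1 x 1≤x = ℚₚ.+-mono-< {0ℚ} {x} {0ℚ} {1ℚ} (ℚₚ.<-≤-trans (ℚₚ.positive⁻¹ 1ℚ) 1≤x) (ℚₚ.positive⁻¹ 1ℚ)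
  choose : ∃[ K ] (∀ {m n} → K ≤ m → K ≤ n → ℚ.∣ seq δ m ℚ.- seq δ n ∣ ℚ.≤ 1ℚ) → ∃[ d ] NatApprox δ d
  choose (K₂ , close) = combine K (m≤m⊔n K₁ K₂)
    (λ K≤n → close (m⊔n≤o⇒n≤o K₁ K₂ K≤n) (m≤n⊔m K₁ K₂) , close (m≤n⊔m K₁ K₂) (m⊔n≤o⇒n≤o K₁ K₂ K≤n))
    (ceiling (seq δ K ℚ.+ 1ℚ) (0<+1 (seq δ K) (1≤δ (m≤m⊔n K₁ K₂))))
    where K = K₁ ⊔ K₂

≤⇒≤+ε : ∀ {x y ε} → 0ℚ ℚ.< ε → x ℚ.≤ y → x ℚ.≤ y ℚ.+ ε
≤⇒≤+ε {x} {y} {ε} 0<ε x≤y = ℚₚ.≤-trans x≤y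
  (subst (ℚ._≤ y ℚ.+ ε) (ℚₚ.+-identityʳ y) (ℚₚ.+-monoʳ-≤ y (ℚₚ.<⇒≤ 0<ε)))

-- Here `b` counts the exceptional primes: b d ≤ π(N) and δ ≤ d give b ≤ π(N) / δ.
closeToπ : ∀ N δ (0<δ : 0ℝ <ᵣ δ) d → NatApprox δ d → ∀ n b → n ≤ π N → π N ≤ n + b → b * d ≤ π N →
           CloseToπ 1ℝ N δ 0<δ n
closeToπ N δ (e , 0<e , K₀ , e≤δ) d (K , approx) n b n≤π π≤n+b bd≤π {ε} 0<ε = K₀ ⊔ K , λ {i} K≤i →
  let δ≤d = proj₁ (approx (m⊔n≤o⇒n≤o K₀ K K≤i))
      -- `d` must also dominate `e`, since `inverse` divides by the truncated term `seq δ i ⊔ e`.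
      e≤d = ℚₚ.≤-trans (subst (ℚ._≤ seq δ i) (ℚₚ.+-identityˡ e) (e≤δ (m⊔n≤o⇒m≤o K₀ K K≤i))) δ≤d
      0<v = ℚₚ.<-≤-trans 0<e (ℚₚ.p≤q⊔p (seq δ i) e)
  in ≤⇒≤+ε 0<ε (bound (seq δ i ℚ.⊔ e) 0<v (ℚₚ.⊔-lub δ≤d e≤d))
  where
  open ℚₚ.≤-Reasoning
  bound : ∀ v (0<v : 0ℚ ℚ.< v) → v ℚ.≤ ℕ→ℚ d →
          ℚ.∣ ℕ→ℚ n ℚ.- ℕ→ℚ (π N) ∣ ℚ.≤ 1ℚ ℚ.* (ℕ→ℚ (π N) ℚ.* recip v 0<v)
  bound v 0<v v≤d = begin
    ℚ.∣ ℕ→ℚ n ℚ.- ℕ→ℚ (π N) ∣             ≤⟨ ∣-∣≤ b n≤π π≤n+b ⟩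
    ℕ→ℚ b
      ≤⟨ ≤*recip v 0<v (ℚₚ.≤-trans (ℚₚ.*-monoˡ-≤-nonNeg (ℕ→ℚ b) {{ℚ.nonNegative (0≤ℕ→ℚ b)}} v≤d)
           (subst (ℚ._≤ ℕ→ℚ (π N)) (ℕ→ℚ-* b d) (ℕ→ℚ-mono-≤ bd≤π))) ⟩
    ℕ→ℚ (π N) ℚ.* recip v 0<v             ≡⟨ ℚₚ.*-identityˡ (ℕ→ℚ (π N) ℚ.* recip v 0<v) ⟨
    1ℚ ℚ.* (ℕ→ℚ (π N) ℚ.* recip v 0<v)    ∎

-- Good primes and their number

module _ (N M : ℕ) .{{_ : NonZero M}} (g : ℕ) (M<4^h : M < 4 ^ suc g) where
  -- M < 4^(g+1) = 2^(2g+2), so log M is at most 2g + 3.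
  ℓ : ℕ
  ℓ = suc (suc g + suc g)

  log≤ℓ : ∀ {i} → mersenne (suc g + suc g) ≤ i → seq (log M) i ℚ.≤ ℕ→ℚ ℓ
  log≤ℓ = LogBound.logSum≤ M (suc g + suc g)
    (≤-trans (<⇒≤ M<4^h) (≤-reflexive (trans (^-*-assoc 2 2 (suc g)) (cong (λ t → 2 ^ (suc g + t)) (+-identityʳ (suc g))))))

  scale≤4* : ∀ k d x e → ℕ→ℚ d ℚ.≤ ℕ→ℚ 4 ℚ.* x →
             ℕ→ℚ (M * k * d) ℚ.≤ ℕ→ℚ 4 ℚ.* (ℕ→ℚ M ℚ.* ℕ→ℚ k ℚ.* x ℚ.⊔ e)
  scale≤4* k d x e d≤4x = begin
    ℕ→ℚ (M * k * d)                ≡⟨ trans (ℕ→ℚ-* (M * k) d) (cong (ℚ._* ℕ→ℚ d) (ℕ→ℚ-* M k)) ⟩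
    Mk ℚ.* ℕ→ℚ d                   ≤⟨ ℚₚ.*-monoˡ-≤-nonNeg Mk {{ℚ.nonNegative (0≤* {ℕ→ℚ M} {ℕ→ℚ k} (0≤ℕ→ℚ M) (0≤ℕ→ℚ k))}} {ℕ→ℚ d} {ℕ→ℚ 4 ℚ.* x} d≤4x ⟩
    Mk ℚ.* (ℕ→ℚ 4 ℚ.* x)           ≡⟨ swap Mk (ℕ→ℚ 4) x ⟩
    ℕ→ℚ 4 ℚ.* (Mk ℚ.* x)           ≤⟨ ℚₚ.*-monoˡ-≤-nonNeg (ℕ→ℚ 4) {Mk ℚ.* x} {Mk ℚ.* x ℚ.⊔ e} (ℚₚ.p≤p⊔q (Mk ℚ.* x) e) ⟩
    ℕ→ℚ 4 ℚ.* (Mk ℚ.* x ℚ.⊔ e)     ∎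
    where
    open ℚₚ.≤-Reasoning
    Mk = ℕ→ℚ M ℚ.* ℕ→ℚ k
    swap : ∀ a f x → a ℚ.* (f ℚ.* x) ≡ f ℚ.* (a ℚ.* x)
    swap = solve 3 (λ a f x → a :* (f :* x) := f :* (a :* x)) refl

  module _ (δ : ℝ) (0<δ : 0ℝ <ᵣ δ) (d : ℕ) (δ≈d : NatApprox δ d) where
    t : ℕ
    t = 4 * π N * ℓ

    0<d : 0ℚ ℚ.< ℕ→ℚ d
    0<d = go 0<δ δ≈d
      where
      go : 0ℝ <ᵣ δ → NatApprox δ d → 0ℚ ℚ.< ℕ→ℚ d
      go (e , 0<e , K₀ , e≤δ) (K , approx) = ℚₚ.<-≤-trans {0ℚ} {e} {ℕ→ℚ d} 0<e
        (ℚₚ.≤-trans {e} {seq δ (K₀ ⊔ K)} {ℕ→ℚ d}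
          (subst (ℚ._≤ seq δ (K₀ ⊔ K)) (ℚₚ.+-identityˡ e) (e≤δ (m≤m⊔n K₀ K)))
          (proj₁ (approx (m≤n⊔m K₀ K))))

    smallDeficit-ℚ : ∀ X p → SmallDeficit (M * length X * d) t X p →
                     ℕ→ℚ (deficit p X) ℚ.* (ℕ→ℚ (M * length X * d) ℚ.+ ℕ→ℚ 4 ℚ.* ℕ→ℚ (π N) ℚ.* ℕ→ℚ ℓ) ℚ.≤
                     ℕ→ℚ 73 ℚ.* (ℕ→ℚ (length X) ℚ.* ℕ→ℚ (M * length X * d))
    smallDeficit-ℚ X p small = subst₂ ℚ._≤_
      (trans (ℕ→ℚ-* (deficit p X) (s + t)) (cong (ℕ→ℚ (deficit p X) ℚ.*_)
        (trans (ℕ→ℚ-+ s t) (cong (ℕ→ℚ s ℚ.+_) (trans (ℕ→ℚ-* (4 * π N) ℓ) (cong (ℚ._* ℕ→ℚ ℓ) (ℕ→ℚ-* 4 (π N))))))))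
      (trans (ℕ→ℚ-* 73 (length X * s)) (cong (ℕ→ℚ 73 ℚ.*_) (ℕ→ℚ-* (length X) s)))
      (ℕ→ℚ-mono-≤ small)
      where s = M * length X * d

    goodPrime : ∀ X p → Prime p → SmallDeficit (M * length X * d) t X p →
                GoodPrime (fromℕ 73) N M δ 0<δ X p
    -- For empty `X` the left side and the error term are both 0.
    goodPrime []         p p-prime _     = p-prime , λ {ε} 0<ε → 0 , λ _ → ≤⇒≤+ε {0ℚ} {0ℚ} {ε} 0<ε ℚₚ.≤-refl
    goodPrime X@(x ∷ xs) p p-prime small = p-prime , λ {ε} 0<ε → K ⊔ K′ , λ {i} K≤i →
      ≤⇒≤+ε 0<ε (bound (seq (log M) i) (seq δ i)
        (log-nonneg M i) (log≤ℓ (m⊔n≤o⇒n≤o K K′ K≤i)) (proj₂ (proj₂ δ≈d (m⊔n≤o⇒m≤o K K′ K≤i))))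
      where
      instance
        p≢0 : NonZero p
        p≢0 = prime⇒nonZero p-prime
      K = proj₁ δ≈d
      K′ = mersenne (suc g + suc g)
      k = length X
      e = proj₁ (Mkδ-pos M k δ 0<δ)
      0<e : 0ℚ ℚ.< e
      0<e = proj₁ (proj₂ (Mkδ-pos M k δ 0<δ))
      0<s : 0ℚ ℚ.< ℕ→ℚ (M * k * d)
      0<s = subst (0ℚ ℚ.<_) (sym (trans (ℕ→ℚ-* (M * k) d) (cong (ℚ._* ℕ→ℚ d) (ℕ→ℚ-* M k))))
        (0<* {ℕ→ℚ M ℚ.* ℕ→ℚ k} {ℕ→ℚ d} (0<* {ℕ→ℚ M} {ℕ→ℚ k} (0<ℕ→ℚ M) (0<ℕ→ℚ k)) 0<d)
      -- `l` and `y` stand for the terms of log M and δ at one index. Then `v` is the truncated term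
      -- of M k δ, and `w` is the term of 1 + R before its own truncation at 1.
      bound : ∀ l y → 0ℚ ℚ.≤ l → l ℚ.≤ ℕ→ℚ ℓ → ℕ→ℚ d ℚ.≤ ℕ→ℚ 4 ℚ.* y →
              let v   = ℕ→ℚ M ℚ.* ℕ→ℚ k ℚ.* y ℚ.⊔ e
                  0<v = ℚₚ.<-≤-trans 0<e (ℚₚ.p≤q⊔p (ℕ→ℚ M ℚ.* ℕ→ℚ k ℚ.* y) e)
                  w   = 1ℚ ℚ.+ ℕ→ℚ (π N) ℚ.* l ℚ.* recip v 0<v
                  0<z = ℚₚ.<-≤-trans (ℚₚ.positive⁻¹ 1ℚ) (ℚₚ.p≤q⊔p w 1ℚ)
              in ℚ.∣ ℕ→ℚ (residueCount p X) ℚ.- ℕ→ℚ k ∣ ℚ.≤ ℕ→ℚ 73 ℚ.* (ℕ→ℚ k ℚ.* recip (w ℚ.⊔ 1ℚ) 0<z)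
      bound l y 0≤l l≤ℓ d≤4y = ℚₚ.≤-trans
        (∣-∣≤ (deficit p X) (residueCount≤length p X) (length≤residueCount+deficit p X))
        (≤*[*recip] (ℕ→ℚ (deficit p X)) (ℕ→ℚ 73) (ℕ→ℚ k) s (s ℚ.+ ℕ→ℚ 4 ℚ.* ℕ→ℚ (π N) ℚ.* ℕ→ℚ ℓ)
          (w ℚ.⊔ 1ℚ) 0<z (0≤ℕ→ℚ (deficit p X)) 0<s
          (1+ratio-upper s (ℕ→ℚ (π N)) l (ℕ→ℚ ℓ) (recip v 0<v) (ℚₚ.<⇒≤ 0<s) (0≤ℕ→ℚ (π N)) 0≤l l≤ℓ
            (ℚₚ.<⇒≤ (0<recip v 0<v)) (*recip≤ {s} {ℕ→ℚ 4} v 0<v (scale≤4* k d y e d≤4y)))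
          (smallDeficit-ℚ X p small))
        where
        s = ℕ→ℚ (M * k * d)
        v = ℕ→ℚ M ℚ.* ℕ→ℚ k ℚ.* y ℚ.⊔ e
        0<v = ℚₚ.<-≤-trans 0<e (ℚₚ.p≤q⊔p (ℕ→ℚ M ℚ.* ℕ→ℚ k ℚ.* y) e)
        w = 1ℚ ℚ.+ ℕ→ℚ (π N) ℚ.* l ℚ.* recip v 0<v
        0<z = ℚₚ.<-≤-trans (ℚₚ.positive⁻¹ 1ℚ) (ℚₚ.p≤q⊔p w 1ℚ)

    -- Small deficit is decidable and implies goodness, so the list `S` of primes with small deficit
    -- can be computed. An exact list `T` of good primes lies between `S` and all primes up to N, so
    -- both lengths differ from π(N) by at most the number of bad primes.
    countGoodPrimes : 4 ^ g ≤ M → (X : List ℕ) → Unique X → All (λ x → 1 ≤ x × x ≤ 10 ^ M) X →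
                      CountUpTo N (GoodPrime (fromℕ 73) N M δ 0<δ X) (CloseToπ 1ℝ N δ 0<δ)
    countGoodPrimes 4^g≤M X uX X-range =
      (S , Unique-filter⁺ small? uprimes , All.tabulate S-good , close (length S) (length-filter small? primes) ≤-refl) ,
      λ T uT T-exact → close (length T)
        (Unique⊆⇒length≤ uT (λ {p} p∈T →
          let p≤N , p-prime , _ = Equivalence.to (T-exact p) p∈T
          in ∈-filter⁺ prime? (∈-upTo⁺ (s≤s p≤N)) p-prime))
        (Unique⊆⇒length≤ (Unique-filter⁺ small? uprimes) (λ {p} p∈S → Equivalence.from (T-exact p) (S-good p∈S)))
      where
      primes = filter prime? (upTo (suc N))
      uprimes : Unique primes
      uprimes = Unique-filter⁺ prime? (upTo⁺ (suc N))
      small? = smallDeficit? (M * length X * d) t X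
      S = filter small? primes
      bad = filter (¬? ∘ small?) primes
      S-good : ∀ {p} → p ∈ S → p ≤ N × GoodPrime (fromℕ 73) N M δ 0<δ X p
      S-good {p} p∈S =
        let p∈primes , small = ∈-filter⁻ small? {xs = primes} p∈S
            p∈upTo , p-prime = ∈-filter⁻ prime? {xs = upTo (suc N)} p∈primes
        in m<1+n⇒m≤n (∈-upTo⁻ p∈upTo) , goodPrime X p p-prime small
      bad-rare : length bad * d ≤ π N
      bad-rare = largeDeficit-rare g 4^g≤M uX (All.map proj₂ X-range) d (π N)
        (Unique-filter⁺ (¬? ∘ small?) uprimes) (All-filter⁺ (¬? ∘ small?) (all-filter prime? (upTo (suc N))))
        (all-filter (¬? ∘ small?) primes)
      close : ∀ n → n ≤ π N → length S ≤ n → CloseToπ 1ℝ N δ 0<δ n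
      close n n≤π S≤n = closeToπ N δ 0<δ d δ≈d n (length bad) n≤π
        (≤-trans (≤-reflexive (sym (count-¬ small? primes))) (+-monoˡ-≤ (length bad) S≤n)) bad-rare

theorem2 : Σ[ C₁ ∈ ℝ ] Σ[ C₂ ∈ ℝ ] Σ[ M₀ ∈ ℕ ]
    ((Δ : ℕ → ℝ) → TendsToInfinity Δ →
    Σ[ N₀ ∈ ℕ ] ((N : ℕ) → N₀ ≤ N →
    Σ[ Δ>0 ∈ 0ℝ <ᵣ Δ N ] ((M : ℕ) .{{_ : NonZero M}} → M₀ ≤ M →
    (X : List ℕ) → Unique X → All (λ x → 1 ≤ x × x ≤ 10 ^ M) X →
    CountUpTo N (GoodPrime C₁ N M (Δ N) Δ>0 X) (CloseToπ C₂ N (Δ N) Δ>0))))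
-- 73 is the constant of `SmallDeficit` and 1 that of `closeToπ`. `N₀` is taken where Δ(N) ≥ 2, so
-- that the terms are eventually at least 1; this gives both the positivity witness and the
-- approximation `d`.
theorem2 = fromℕ 73 , 1ℝ , 0 , λ Δ Δ→∞ →
  let N₀ , 2≤Δ = Δ→∞ (fromℕ 2)
  in N₀ , λ N N₀≤N →
    let K , 1≤Δ = eventually≥1 (Δ N) (2≤Δ N N₀≤N)
        d , Δ≈d = natApprox (Δ N) (K , 1≤Δ)
        Δ>0 = 1ℚ , ℚₚ.positive⁻¹ 1ℚ , K , λ {n} K≤n → subst (ℚ._≤ seq (Δ N) n) (sym (ℚₚ.+-identityˡ 1ℚ)) (1≤Δ K≤n)
    in Δ>0 , λ M _ X uX X-range →
      let g , 4^g≤M , M<4^h = log₄-bracket M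
      in countGoodPrimes N M g M<4^h (Δ N) Δ>0 d Δ≈d 4^g≤M X uX X-range
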